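{- Let $G$ and $G+x$ be connected graphs, and let $ST(G)=(T,\mathcal F)$ be marked with respect to the set $N(x)$ of leaves. If $ST(G)$ contains a unique hybrid node $u$ and $u$ is degenerate, then $ST(G+x)$ is obtained in two steps: 1. performing the node-split of $u$ corresponding to $(P^*(u),E^*(u))$, thus creating a tree-edge $e$ both of whose extremities are perfect or empty; 2. subdividing $e$ with a new ternary node adjacent to the leaf $x$ and to $e$'s extremities, such that the new node is a clique if both extremities of $e$ are perfect, and is otherwise a star whose centre is the opposite of $e$'s empty extremity.
   Context: Graphs are finite, simple and undirected. $G+x$ is obtained from $G$ by adding a new vertex $x$ with neighbourhood $N(x)\subseteq V(G)$. For a vertex set $S$, $N(S)=(\bigcup_{y\in S}N(y))\setminus S$. Splits. A split of a connected graph is a bipartition $(A,B)$ of its vertex set with $|A|,|B|>1$ such that every vertex of $A'=N(B)$ is adjacent to every vertex of $B'=N(A)$; $A',B'$ are its frontiers. A star is a graph with at least three vertices having one vertex (its centre) adjacent to all others and no other edges. Cliques (complete graphs) and stars are degenerate; a graph with no split that is not degenerate is prime. Graph-labelled trees. A graph-labelled tree (GLT) $(T,\mathcal F)$ is a tree $T$ whose non-leaf vertices are called nodes (each of degree at least 3), where each node $u$ is labelled by a graph $G(u)\in\mathcal F$ together with a bijection $\rho_u$ from the tree-edges incident to $u$ to $V(u):=V(G(u))$. A node is called clique, star, prime, degenerate according to its label. Vertices of labels are marker vertices; edges of labels are label-edges. The extremities of a tree-edge $e$ are: at an end that is a node $u$, the marker vertex $\rho_u(e)$; at an end that is a leaf,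 the leaf itself. The two extremities of a tree-edge are opposite to each other. Two elements (leaves or marker vertices) are accessible from one another if there is a sequence of leaves and marker vertices joining them whose consecutive elements are either the two extremities of a tree-edge or the two vertices of a label-edge, with tree-edges and label-edges alternating. The accessibility graph of the GLT has the leaves of $T$ as vertices, distinct leaves being adjacent iff accessible from one another. Node-joins and node-splits. For a tree-edge between nodes $u,u'$ with extremities $q\in V(u)$, $q'\in V(u')$, the node-join replaces $u,u'$ by one node labelled by the graph obtained from $G(u)$ and $G(u')$ by adding all edges between $N(q)$ and $N(q')$ and deleting $q,q'$. It is a clique-join if both labels are cliques, and a star-join if both are stars and exactly one of $q,q'$ is the centre of its star. Conversely, if $G(v)$ has a split $(A,B)$ with frontiers $A',B'$, the node-split of $v$ with respect to $(A,B)$ replaces $v$ by two adjacent nodes labelled $G(v)[A]+q$ and $G(v)[B]+q'$, where $q,q'$ are the extremities of the new tree-edge, $N(q)=A'$ and $N(q')=B'$; other tree-edges keep their extremities. A GLT is reduced if all its labels are prime or degenerate and no clique-join or star-join is possible. Every connected graph $G$ is the accessibility graph of a unique reduced GLT, the split-tree $ST(G)$. Subdividing a tree-edge $e$ with a new ternary node adjacent to $x$ means replacing $e$ by a path through a new node $w$ with a new leaf $x$ attached to $w$; the extremities of $e$ become opposites of two of the three marker vertices of $w$, and $x$ is the opposite of the third. States. For a marker vertex $q\in V(u)$ corresponding to the tree-edge $e$, $L(q)$ is the set of leaves in the component of $T-e$ not containing $u$, and $A(q)$ is the set of leaves of $L(q)$ accessible from $q$. For a leaf $\ell$, $L(\ell)$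 is the set of all other leaves and $A(\ell)=N_G(\ell)$. With respect to a set $S$ of leaves (here $S=N(x)$), a leaf or marker vertex $q$ is perfect if $S\cap L(q)=A(q)$, empty if $S\cap L(q)=\emptyset$, and mixed otherwise. A node $u$ is hybrid if every $q\in V(u)$ is perfect or empty and the opposite of every $q\in V(u)$ is mixed. For a degenerate node $u$: $P^*(u)=\{q\in V(u): q$ is perfect and not the centre of a star$\}$ and $E^*(u)=\{q\in V(u): q$ is empty, or $q$ is perfect and the centre of a star$\}$. -}

module Defs where

open import Data.Bool.Base using (Bool; true; false; T; not; _∧_; if_then_else_)
open import Data.Bool.ListAction using (any)
open import Data.Bool.Properties using (T?; T-irrelevant)
open import Data.Empty using (⊥-elim)
open import Data.Empty.Irrelevant using () renaming (⊥-elim to ⊥-elim-irr)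
open import Data.Fin.Base using (Fin)
open import Data.List.Base using (List; []; _∷_; _∷ʳ_; map; length)
open import Data.List.Membership.Propositional using (_∈_)
open import Data.List.Membership.Propositional.Properties using (∈-map⁺)
open import Data.List.Relation.Unary.Any using (here; there)
open import Data.List.Relation.Unary.Linked using (Linked)
open import Data.List.Relation.Unary.Unique.Propositional using (Unique)
open import Data.Maybe.Base using (Maybe; just; nothing)
import Data.Maybe.Properties as Maybe
open import Data.Nat.Base using (ℕ; _≤_)
open import Data.Product using (∃; ∃₂; _×_; _,_; proj₁)
open import Data.Sum.Base using (_⊎_; inj₁; inj₂)
open import Function.Base using (_∘_)
open import Function.Bundles using (_↣_; _⇔_)
open import Level using (0ℓ)
open import Relation.Binary.Construct.Closure.ReflexiveTransitive using (Star)
open import Relation.Binary.Core using (Rel)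
open import Relation.Binary.Definitions using (DecidableEquality)
open import Relation.Binary.PropositionalEquality
  using (_≡_; _≢_; refl; sym; cong)
open import Relation.Nullary using (¬_; yes; no; does)
import Relation.Unary as U
open U using (Pred; _∩_; _≐_)

private variable
  V : Set

------------------------------------------------------------------------
-- Finite sets and their subsets

record Finite (V : Set) : Set where
  infix 4 _≟_
  field
    _≟_      : DecidableEquality V
    elements : List V
    complete : ∀ v → v ∈ elements

Subset : Set → Set
Subset V = V → Bool

⟦_⟧ : Subset V → Pred V 0ℓ
⟦ S ⟧ v = T (S v)

∁ : Subset V → Subset V
∁ S = not ∘ S

AtLeast : ℕ → Set → Set
AtLeast k V = Fin k ↣ V

maybe-finite : Finite V → Finite (Maybe V)
maybe-finite F = record
  { _≟_      = Maybe.≡-dec _≟_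
  ; elements = nothing ∷ map just elements
  ; complete = λ { nothing → here refl ; (just v) → there (∈-map⁺ just (complete v)) }
  } where open Finite F

subset-finite : Finite V → (S : Subset V) → Finite (∃ ⟦ S ⟧)
subset-finite {V} F S = record
  { _≟_      = dec
  ; elements = select elements
  ; complete = λ { (v , p) → select-complete p (complete v) }
  }
  where
  open Finite F

  dec : DecidableEquality (∃ ⟦ S ⟧)
  dec (v , p) (w , q) with v ≟ w
  ... | yes refl = yes (cong (v ,_) (T-irrelevant p q))
  ... | no  v≢w  = no (v≢w ∘ cong proj₁)

  select : List V → List (∃ ⟦ S ⟧)
  select []       = []
  select (v ∷ vs) with T? (S v)
  ... | yes p = (v , p) ∷ select vs
  ... | no  _ = select vs

  select-complete : ∀ {v vs} (p : ⟦ S ⟧ v) → v ∈ vs → (v , p) ∈ select vs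
  select-complete {v} p (here refl) with T? (S v)
  ... | yes p′ = here (cong (v ,_) (T-irrelevant p p′))
  ... | no  ¬p = ⊥-elim (¬p p)
  select-complete {vs = w ∷ _} p (there v∈vs) with T? (S w)
  ... | yes _ = there (select-complete p v∈vs)
  ... | no  _ = select-complete p v∈vs

------------------------------------------------------------------------
-- Connected relations and trees

ConnectedBy : Rel V 0ℓ → Set
ConnectedBy R = ∀ u v → Star R u v

Cycle : Rel V 0ℓ → Set
Cycle R = ∃₂ λ v vs → 2 ≤ length vs × Unique (v ∷ vs) × Linked R (v ∷ vs ∷ʳ v)

-- For a symmetric irreflexive relation R.
IsTree : Rel V 0ℓ → Set
IsTree R = ConnectedBy R × ¬ Cycle R

------------------------------------------------------------------------
-- Graphs

record GraphOn (V : Set) : Set where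
  field
    adj    : V → V → Bool
    symm   : ∀ u v → adj u v ≡ adj v u
    irrefl : ∀ v → adj v v ≡ false

record Graph : Set₁ where
  field
    Vertex  : Set
    finite  : Finite Vertex
    graphOn : GraphOn Vertex
  open Finite finite public
  open GraphOn graphOn public

  Adj : Rel Vertex 0ℓ
  Adj u v = T (adj u v)

  -- The neighbourhood N(S) of a set of vertices S.
  N[_] : Subset Vertex → Subset Vertex
  N[ S ] v = not (S v) ∧ any (λ y → S y ∧ adj y v) elements

open Graph using (Vertex; Adj; N[_])

Connected : Graph → Set
Connected G = ConnectedBy (Adj G)

-- G ⊕ N is G + x with N(x) = N; the new vertex x is nothing.
infixl 6 _⊕_
_⊕_ : (G : Graph) → Subset (Vertex G) → Graph
G ⊕ N = record
  { Vertex  = Maybe (Vertex G)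
  ; finite  = maybe-finite (Graph.finite G)
  ; graphOn = record { adj = adj′ ; symm = symm′ ; irrefl = irrefl′ }
  }
  where
  open Graph G using (adj; symm; irrefl)

  adj′ : Maybe (Vertex G) → Maybe (Vertex G) → Bool
  adj′ (just u) (just v) = adj u v
  adj′ (just u) nothing  = N u
  adj′ nothing  (just v) = N v
  adj′ nothing  nothing  = false

  symm′ : ∀ u v → adj′ u v ≡ adj′ v u
  symm′ (just u) (just v) = symm u v
  symm′ (just u) nothing  = refl
  symm′ nothing  (just v) = refl
  symm′ nothing  nothing  = refl

  irrefl′ : ∀ v → adj′ v v ≡ false
  irrefl′ (just v) = irrefl v
  irrefl′ nothing  = refl

induced : (G : Graph) → Subset (Vertex G) → Graph
induced G S = record
  { Vertex  = ∃ ⟦ S ⟧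
  ; finite  = subset-finite (Graph.finite G) S
  ; graphOn = record
    { adj    = λ (u , _) (v , _) → adj u v
    ; symm   = λ (u , _) (v , _) → symm u v
    ; irrefl = λ (v , _) → irrefl v
    }
  } where open Graph G using (adj; symm; irrefl)

IsClique : Graph → Set
IsClique G = ∀ u v → u ≢ v → Adj G u v

IsStarCentre : (G : Graph) → Vertex G → Set
IsStarCentre G c =
  AtLeast 3 (Vertex G) ×
  (∀ v → v ≢ c → Adj G c v) ×
  (∀ u v → Adj G u v → u ≡ c ⊎ v ≡ c)

IsStar : Graph → Set
IsStar G = ∃ (IsStarCentre G)

IsDegenerate : Graph → Set
IsDegenerate G = IsClique G ⊎ IsStar G

cliqueOn : Finite V → GraphOn V
cliqueOn F = record { adj = adj′ ; symm = symm′ ; irrefl = irrefl′ }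
  where
  open Finite F

  adj′ : _ → _ → Bool
  adj′ u v = not (does (u ≟ v))

  symm′ : ∀ u v → adj′ u v ≡ adj′ v u
  symm′ u v with u ≟ v | v ≟ u
  ... | yes _   | yes _   = refl
  ... | no _    | no _    = refl
  ... | yes u≡v | no v≢u  = ⊥-elim (v≢u (sym u≡v))
  ... | no u≢v  | yes v≡u = ⊥-elim (u≢v (sym v≡u))

  irrefl′ : ∀ v → adj′ v v ≡ false
  irrefl′ v with v ≟ v
  ... | yes _  = refl
  ... | no v≢v = ⊥-elim (v≢v refl)

-- The star with centre c: u and v are adjacent iff exactly one of them is c.
starOn : Finite V → V → GraphOn V
starOn F c = record { adj = adj′ ; symm = symm′ ; irrefl = irrefl′ }
  where
  open Finite F

  adj′ : _ → _ → Bool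
  adj′ u v = if does (u ≟ c) then not (does (v ≟ c)) else does (v ≟ c)

  symm′ : ∀ u v → adj′ u v ≡ adj′ v u
  symm′ u v with does (u ≟ c) | does (v ≟ c)
  ... | true  | true  = refl
  ... | true  | false = refl
  ... | false | true  = refl
  ... | false | false = refl

  irrefl′ : ∀ v → adj′ v v ≡ false
  irrefl′ v with does (v ≟ c)
  ... | true  = refl
  ... | false = refl

------------------------------------------------------------------------
-- Splits

-- The bipartition is (A, ∁ A).
record Split (G : Graph) : Set where
  field
    A         : Subset (Vertex G)
    connected : Connected G
    |A|>1     : AtLeast 2 (∃ ⟦ A ⟧)
    |B|>1     : AtLeast 2 (∃ ⟦ ∁ A ⟧)
    joined    : ∀ a b → ⟦ N[_] G (∁ A) ⟧ a → ⟦ N[_] G A ⟧ b → Adj G a b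

  B A′ B′ : Subset (Vertex G)
  B  = ∁ A
  A′ = N[_] G B
  B′ = N[_] G A

-- Splits are defined for connected graphs only, hence so is primality.
IsPrime : Graph → Set
IsPrime G = Connected G × ¬ Split G × ¬ IsDegenerate G

------------------------------------------------------------------------
-- Graph-labelled trees

-- Leaves and marker vertices.
data Element (Leaf : Set) {Node : Set} (label : Node → Graph) : Set where
  leaf   : Leaf → Element Leaf label
  marker : (u : Node) → Vertex (label u) → Element Leaf label

-- The data of a graph-labelled tree.  A tree-edge is given by its two
-- extremities, which opposite exchanges, and it joins the leaves or nodes
-- they belong to; thus ρ_u⁻¹(q) is the tree-edge with extremities q and
-- opposite q.  The laws are in IsGLT below.
record GLT (Leaf : Set) : Set₁ where
  field
    Node     : Set
    leaves   : Finite Leaf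
    nodes    : Finite Node
    label    : Node → Graph
    opposite : Element Leaf label → Element Leaf label

  TreeVertex : Set
  TreeVertex = Leaf ⊎ Node

  end : Element Leaf label → TreeVertex
  end (leaf ℓ)     = inj₁ ℓ
  end (marker u _) = inj₂ u

  TreeAdj : Rel TreeVertex 0ℓ
  TreeAdj a b = ∃ λ q → end q ≡ a × end (opposite q) ≡ b

  -- Adjacency in T - e, where q is an extremity of e.
  TreeAdjWithout : Element Leaf label → Rel TreeVertex 0ℓ
  TreeAdjWithout q a b =
    ∃ λ r → r ≢ q × r ≢ opposite q × end r ≡ a × end (opposite r) ≡ b

  _≟ᴱ_ : DecidableEquality (Element Leaf label)
  leaf ℓ ≟ᴱ leaf m with Finite._≟_ leaves ℓ m
  ... | yes refl = yes refl
  ... | no  ℓ≢m  = no λ { refl → ℓ≢m refl }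
  leaf _ ≟ᴱ marker _ _ = no λ ()
  marker _ _ ≟ᴱ leaf _ = no λ ()
  marker u q ≟ᴱ marker v r with Finite._≟_ nodes u v
  ... | no  u≢v  = no λ { refl → u≢v refl }
  ... | yes refl with Graph._≟_ (label u) q r
  ...   | yes refl = yes refl
  ...   | no  q≢r  = no λ { refl → q≢r refl }

data EdgeKind : Set where
  tree-edge label-edge : EdgeKind

other : EdgeKind → EdgeKind
other tree-edge  = label-edge
other label-edge = tree-edge

module _ {Leaf : Set} (τ : GLT Leaf) where
  open GLT τ

  record IsGLT : Set where
    field
      involutive : ∀ q → opposite (opposite q) ≡ q
      loop-free  : ∀ q → end q ≢ end (opposite q)
      -- No parallel tree-edges: each ρ_u is a bijection onto V(u), and each
      -- leaf has degree one.
      simple     : ∀ q r → end q ≡ end r → end (opposite q) ≡ end (opposite r) → q ≡ r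
      tree       : IsTree TreeAdj
      degree≥3   : ∀ u → AtLeast 3 (Vertex (label u))

  data Joined : EdgeKind → Rel (Element Leaf label) 0ℓ where
    across : ∀ q → Joined tree-edge q (opposite q)
    within : ∀ {u q r} → Adj (label u) q r → Joined label-edge (marker u q) (marker u r)

  infixr 5 _∷_

  -- Alternating sequences whose first edge, if any, is of the given kind.
  data Alternating : EdgeKind → Rel (Element Leaf label) 0ℓ where
    []  : ∀ {k q} → Alternating k q q
    _∷_ : ∀ {k q r s} → Joined k q r → Alternating (other k) r s → Alternating k q s

  Accessible : Rel (Element Leaf label) 0ℓ
  Accessible q r = ∃ λ k → Alternating k q r

  CliqueJoin : Node → Node → Set
  CliqueJoin u u′ = IsClique (label u) × IsClique (label u′)

  StarJoin : ∀ u u′ → Vertex (label u) → Vertex (label u′) → Set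
  StarJoin u u′ q q′ =
    IsStar (label u) × IsStar (label u′) ×
    ( (IsStarCentre (label u) q × ¬ IsStarCentre (label u′) q′)
    ⊎ (¬ IsStarCentre (label u) q × IsStarCentre (label u′) q′))

  IsReduced : Set
  IsReduced =
    (∀ u → IsPrime (label u) ⊎ IsDegenerate (label u)) ×
    (∀ u q u′ q′ → opposite (marker u q) ≡ marker u′ q′ →
      ¬ CliqueJoin u u′ × ¬ StarJoin u u′ q q′)

  ----------------------------------------------------------------------
  -- States

  L : Element Leaf label → Pred Leaf 0ℓ
  L (leaf ℓ)       m = m ≢ ℓ
  L q@(marker u _) m = ¬ Star (TreeAdjWithout q) (inj₂ u) (inj₁ m)

  -- For a leaf ℓ this is the neighbourhood of ℓ in the accessibility graph.
  Acc : Element Leaf label → Pred Leaf 0ℓ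
  Acc q m = L q m × Accessible q (leaf m)

  module _ (S : Subset Leaf) where

    Perfect Empty Mixed : Element Leaf label → Set
    Perfect q = (⟦ S ⟧ ∩ L q) ≐ Acc q
    Empty   q = U.Empty (⟦ S ⟧ ∩ L q)
    Mixed   q = ¬ Perfect q × ¬ Empty q

    IsHybrid : Node → Set
    IsHybrid u =
      (∀ q → Perfect (marker u q) ⊎ Empty (marker u q)) ×
      (∀ q → Mixed (opposite (marker u q)))

    P* E* : (u : Node) → Pred (Vertex (label u)) 0ℓ
    P* u q = Perfect (marker u q) × ¬ IsStarCentre (label u) q
    E* u q = Empty (marker u q) ⊎ (Perfect (marker u q) × IsStarCentre (label u) q)

IsAccessibilityGraph : (G : Graph) → GLT (Vertex G) → Set
IsAccessibilityGraph G τ =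
  ∀ ℓ m → ℓ ≢ m → Adj G ℓ m ⇔ Accessible τ (leaf ℓ) (leaf m)

-- τ is the split-tree of G (which is unique up to renaming nodes and markers).
IsSplitTree : (G : Graph) → GLT (Vertex G) → Set
IsSplitTree G τ = IsGLT τ × IsReduced τ × IsAccessibilityGraph G τ

------------------------------------------------------------------------
-- Node-splits

-- The nodes after splitting u.
data SplitNode {Node : Set} (u : Node) : Set where
  old         : (v : Node) → .(v ≢ u) → SplitNode u
  nodeA nodeB : SplitNode u

splitNode-finite : {Node : Set} → Finite Node → (u : Node) → Finite (SplitNode u)
splitNode-finite {Node} F u = record
  { _≟_      = dec
  ; elements = nodeA ∷ nodeB ∷ select elements
  ; complete = λ { nodeA → here refl
                 ; nodeB → there (here refl)
                 ; (old v p) → there (there (select-complete p (complete v))) }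
  }
  where
  open Finite F

  dec : DecidableEquality (SplitNode u)
  dec (old v _) (old w _) with v ≟ w
  ... | yes refl = yes refl
  ... | no  v≢w  = no λ { refl → v≢w refl }
  dec (old _ _) nodeA     = no λ ()
  dec (old _ _) nodeB     = no λ ()
  dec nodeA     (old _ _) = no λ ()
  dec nodeA     nodeA     = yes refl
  dec nodeA     nodeB     = no λ ()
  dec nodeB     (old _ _) = no λ ()
  dec nodeB     nodeA     = no λ ()
  dec nodeB     nodeB     = yes refl

  select : List Node → List (SplitNode u)
  select []       = []
  select (v ∷ vs) with v ≟ u
  ... | yes _  = select vs
  ... | no v≢u = old v v≢u ∷ select vs

  select-complete : ∀ {v vs} .(v≢u : v ≢ u) → v ∈ vs → old v v≢u ∈ select vs
  select-complete {v} v≢u (here refl) with v ≟ u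
  ... | no _    = here refl
  ... | yes v≡u = ⊥-elim-irr (v≢u v≡u)
  select-complete {vs = w ∷ _} v≢u (there v∈vs) with w ≟ u
  ... | yes _ = select-complete v≢u v∈vs
  ... | no _  = there (select-complete v≢u v∈vs)

module _ {Leaf : Set} (τ : GLT Leaf) (u : GLT.Node τ) (s : Split (GLT.label τ u)) where
  open GLT τ
  open Split s

  splitLabel : SplitNode u → Graph
  splitLabel (old v _) = label v
  splitLabel nodeA     = induced (label u) A ⊕ (A′ ∘ proj₁)
  splitLabel nodeB     = induced (label u) B ⊕ (B′ ∘ proj₁)

  splitMarker : Vertex (label u) → Element Leaf splitLabel
  splitMarker q with T? (A q) | T? (B q)
  ... | yes q∈A | _       = marker nodeA (just (q , q∈A))
  ... | no _    | yes q∈B = marker nodeB (just (q , q∈B))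
  ... | no q∉A  | no q∉B  = ⊥-elim (absurd (A q) q∉A q∉B)
    where
    absurd : ∀ b → ¬ T b → ¬ ¬ T (not b)
    absurd true  ¬p _  = ¬p _
    absurd false _  ¬p = ¬p _

  splitElement : Element Leaf label → Element Leaf splitLabel
  splitElement (leaf ℓ) = leaf ℓ
  splitElement (marker v q) with Finite._≟_ nodes v u
  ... | yes refl = splitMarker q
  ... | no  v≢u  = marker (old v v≢u) q

  -- The extremities of the new tree-edge, in nodeA and nodeB respectively.
  splitEdgeA splitEdgeB : Element Leaf splitLabel
  splitEdgeA = marker nodeA nothing
  splitEdgeB = marker nodeB nothing

  splitOpposite : Element Leaf splitLabel → Element Leaf splitLabel
  splitOpposite (leaf ℓ)                     = splitElement (opposite (leaf ℓ))
  splitOpposite (marker (old v _) q)         = splitElement (opposite (marker v q))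
  splitOpposite (marker nodeA (just (q , _))) = splitElement (opposite (marker u q))
  splitOpposite (marker nodeB (just (q , _))) = splitElement (opposite (marker u q))
  splitOpposite (marker nodeA nothing)       = splitEdgeB
  splitOpposite (marker nodeB nothing)       = splitEdgeA

  nodeSplit : GLT Leaf
  nodeSplit = record
    { Node     = SplitNode u
    ; leaves   = leaves
    ; nodes    = splitNode-finite nodes u
    ; label    = splitLabel
    ; opposite = splitOpposite
    }

------------------------------------------------------------------------
-- Subdividing a tree-edge

-- The markers of the new ternary node: the opposites of the chosen extremity
-- q of the tree-edge, of the extremity opposite to q, and of the new leaf.
data Ternary : Set where
  opp-q opp-q′ opp-x : Ternary

ternary-finite : Finite Ternary
ternary-finite = record
  { _≟_      = dec
  ; elements = opp-q ∷ opp-q′ ∷ opp-x ∷ []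
  ; complete = λ { opp-q  → here refl
                 ; opp-q′ → there (here refl)
                 ; opp-x  → there (there (here refl)) }
  }
  where
  dec : DecidableEquality Ternary
  dec opp-q  opp-q  = yes refl
  dec opp-q  opp-q′ = no λ ()
  dec opp-q  opp-x  = no λ ()
  dec opp-q′ opp-q  = no λ ()
  dec opp-q′ opp-q′ = yes refl
  dec opp-q′ opp-x  = no λ ()
  dec opp-x  opp-q  = no λ ()
  dec opp-x  opp-q′ = no λ ()
  dec opp-x  opp-x  = yes refl

clique₃ : GraphOn Ternary
clique₃ = cliqueOn ternary-finite

star₃ : Ternary → GraphOn Ternary
star₃ = starOn ternary-finite

-- Both the new leaf and the new node are nothing.
module _ {Leaf : Set} (τ : GLT Leaf) (q : Element Leaf (GLT.label τ)) (W : GraphOn Ternary) where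
  open GLT τ

  subdivideLabel : Maybe Node → Graph
  subdivideLabel (just v) = label v
  subdivideLabel nothing  =
    record { Vertex = Ternary ; finite = ternary-finite ; graphOn = W }

  keep : Element Leaf label → Element (Maybe Leaf) subdivideLabel
  keep (leaf ℓ)     = leaf (just ℓ)
  keep (marker v r) = marker (just v) r

  oppositeOfOld : Element Leaf label → Element (Maybe Leaf) subdivideLabel
  oppositeOfOld r with r ≟ᴱ q | r ≟ᴱ opposite q
  ... | yes _ | _     = marker nothing opp-q
  ... | no _  | yes _ = marker nothing opp-q′
  ... | no _  | no _  = keep (opposite r)

  subdivideOpposite : Element (Maybe Leaf) subdivideLabel → Element (Maybe Leaf) subdivideLabel
  subdivideOpposite (leaf (just ℓ))         = oppositeOfOld (leaf ℓ)
  subdivideOpposite (leaf nothing)          = marker nothing opp-x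
  subdivideOpposite (marker (just v) r)     = oppositeOfOld (marker v r)
  subdivideOpposite (marker nothing opp-q)  = keep q
  subdivideOpposite (marker nothing opp-q′) = keep (opposite q)
  subdivideOpposite (marker nothing opp-x)  = leaf nothing

  subdivide : GLT (Maybe Leaf)
  subdivide = record
    { Node     = Maybe Node
    ; leaves   = maybe-finite leaves
    ; nodes    = maybe-finite nodes
    ; label    = subdivideLabel
    ; opposite = subdivideOpposite
    }

{-# OPTIONS --safe #-}

-- In a tree the leaves L(q) beyond an extremity q, and those accessible from q,
-- are the ends of the non-backtracking walks crossing q (for the latter, along
-- label-edges), so both are computed from the walks beyond the other markers of
-- the next node.  Hence at a hybrid node u the opposite of a marker q being
-- mixed means that some other marker is perfect and that, among the others,
-- "perfect" does not coincide with "adjacent to q"; for a clique or a star this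
-- yields two elements in each of P*(u) and E*(u).  All of P*(u) is perfect and,
-- in the split label, adjacent to the new marker, so the extremity in the
-- E*-node is always perfect; the other one is perfect if u is a star with
-- perfect centre and empty otherwise.  The walks from x through the new node
-- then end exactly in N(x), and no new join appears because a join at one of the
-- two halves of u along an old tree-edge would already be a join at u.
module Submission where

open import Defs
open import Data.Bool.Base using (true; false; T; _∧_)
open import Data.Bool.Properties using (T?; T-irrelevant; T-∧)
open import Data.Empty using (⊥; ⊥-elim)
open import Data.Empty.Irrelevant using () renaming (⊥-elim to ⊥-elim-irr)
open import Data.Fin.Base using (Fin; zero; suc)
import Data.Fin.Properties as Fin
open import Data.List.Base using (List; []; _∷_; _∷ʳ_; _++_; map; length; filter)
open import Data.List.Properties using (filter-notAll)
open import Data.List.Membership.Propositional using (_∈_; lose)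
open import Data.List.Membership.Propositional.Properties
  using (∈-map⁺; ∈-++⁺ˡ; ∈-++⁺ʳ; ∈-filter⁺)
import Data.List.Membership.DecPropositional as DecMembership
open import Data.List.Relation.Unary.All using (All; []; _∷_)
open import Data.List.Relation.Unary.All.Properties using (¬Any⇒All¬)
open import Data.List.Relation.Unary.AllPairs using ([]; _∷_)
open import Data.List.Relation.Unary.Any using (here; there; any?; satisfied)
open import Data.List.Relation.Unary.Any.Properties using (any⁺; any⁻)
open import Data.List.Relation.Unary.Linked using (Linked; [-]; _∷_)
open import Data.List.Relation.Unary.Unique.Propositional using (Unique)
open import Data.Maybe.Base using (Maybe; just; nothing)
open import Data.Maybe.Properties using (just-injective)
open import Data.Nat.Base using (zero; suc; _≤_; z≤n; s≤s; s≤s⁻¹)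
open import Data.Nat.Properties using (≤-trans; ≤-refl; ≤⇒≯)
open import Data.Product using (Σ; ∃; ∃₂; _×_; _,_; proj₁; proj₂; map₂)
open import Data.Sum.Base using (_⊎_; inj₁; inj₂; [_,_]′)
open import Data.Sum.Properties using (inj₁-injective) renaming (≡-dec to ⊎-≡-dec)
open import Function.Base using (_∘_; id; case_of_)
open import Function.Bundles using (_⇔_; mk⇔; mk↣; Injection; Equivalence)
open import Level using (0ℓ)
open import Relation.Binary.Construct.Closure.ReflexiveTransitive
  using (Star; ε; _◅_; _◅◅_; reverse) renaming (map to Star-map)
open import Relation.Binary.Core using (Rel)
open import Relation.Binary.Definitions using (DecidableEquality)
open import Relation.Binary.PropositionalEquality
  using (_≡_; _≢_; refl; sym; trans; cong; subst; ≢-sym)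
open import Relation.Nullary using (¬_; Dec; yes; no; contradiction)
open import Relation.Nullary.Decidable
  using (⌊_⌋; toWitness; fromWitness; fromWitnessFalse; _×-dec_; _⊎-dec_; ¬?; map′)
open import Relation.Unary using (Pred; Decidable; _≐_)

-- The extremity in one half of `u` looks at the leaves behind the other half: the new marker of the
-- `P*` half is governed by `E*`, and conversely. This explains why a perfect centre goes to `E*`.
-- Kept with the perfect leaves of the star, it would be the whole frontier of its side, and the
-- members of N(x) behind those leaves could not be reached from the new edge. In `E*` it is the
-- only frontier marker of that side, and everything beside it there is empty.
--
-- A constructive obstacle is that `Mixed` consists of two negations, whereas a split needs actual
-- markers. The hybrid condition gives each marker of `u` a state; the states exclude each other
-- because some leaf is accessible from every marker of a reduced tree. Perfection is therefore
-- decidable at `u`, and a search through its finitely many markers turns the negations into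
-- witnesses.
--
-- Walks are parametrised by the relation followed inside a node, so that each tree operation is
-- treated once for all walks and for walks along label-edges. The first instance gives acyclicity
-- of the new trees, the second accessibility.

private variable
  X : Set

-- Finite sets, paths and graphs

∃? : {P : Pred X 0ℓ} → Finite X → Decidable P → Dec (∃ P)
∃? F P? = map′ satisfied (λ (v , p) → lose (complete v) p) (any? P? elements)
  where open Finite F

atLeast2 : {a b : X} → a ≢ b → AtLeast 2 X
atLeast2 {a = a} {b} a≢b = mk↣ {to = to} injective
  where
  to : Fin 2 → _
  to zero    = a
  to (suc _) = b

  injective : ∀ {i j} → to i ≡ to j → i ≡ j
  injective {zero}     {zero}     _ = refl
  injective {suc zero} {suc zero} _ = refl
  injective {zero}     {suc zero} e = contradiction e a≢b
  injective {suc zero} {zero}     e = contradiction (sym e) a≢b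

atLeast3⇒∃≢ : DecidableEquality X → AtLeast 3 X → ∀ a → ∃₂ λ b c → b ≢ a × c ≢ a × b ≢ c
atLeast3⇒∃≢ _≟_ f a = choose (to zero ≟ a) (to (suc zero) ≟ a)
  where
  open Injection f using (to; injective)

  distinct : ∀ {i j} → i ≢ j → to i ≢ to j
  distinct i≢j e = i≢j (injective e)

  choose : Dec (to zero ≡ a) → Dec (to (suc zero) ≡ a) → ∃₂ λ b c → b ≢ a × c ≢ a × b ≢ c
  choose (no ≢a) (no ≢a′)     = _ , _ , ≢a , ≢a′ , distinct λ ()
  choose (yes refl) _         = to (suc zero) , to (suc (suc zero)) ,
    distinct (λ ()) , distinct (λ ()) , distinct λ ()
  choose (no ≢a) (yes refl)   = to zero , to (suc (suc zero)) ,
    ≢a , distinct (λ ()) , distinct λ ()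

atLeast-Maybe : ∀ {k} → AtLeast k X → AtLeast (suc k) (Maybe X)
atLeast-Maybe {X = X} {k} f = mk↣ {to = to′} injective′
  where
  open Injection f using (to; injective)

  to′ : Fin (suc k) → Maybe X
  to′ zero    = nothing
  to′ (suc i) = just (to i)

  injective′ : ∀ {i j} → to′ i ≡ to′ j → i ≡ j
  injective′ {zero}  {zero}  _ = refl
  injective′ {suc _} {suc _} e = cong suc (injective (just-injective e))

Star-closed : {R : Rel X 0ℓ} (P : Pred X 0ℓ) → (∀ {a b} → P a → R a b → P b) →
              ∀ {a b} → P a → Star R a b → P b
Star-closed P closed p ε        = p
Star-closed P closed p (r ◅ rs) = Star-closed P closed (closed p r) rs

module _ {R : Rel X 0ℓ} where

  infixr 5 _∷_
  -- The list holds the vertices after the start, the end included. Thus `Unique (a ∷ vs)` makes the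
  -- path simple, and closing it by one more edge gives the shape required by `Cycle`.
  data Path : X → List X → X → Set where
    []  : ∀ {a} → Path a [] a
    _∷_ : ∀ {a b c vs} → R a b → Path b vs c → Path a (b ∷ vs) c

  Path-suffix : ∀ {a b c vs} → a ∈ vs → Path b vs c → Unique vs →
                ∃ λ ws → Path a ws c × Unique (a ∷ ws)
  Path-suffix (here refl) (_ ∷ p) u       = _ , p , u
  Path-suffix (there a∈)  (_ ∷ p) (_ ∷ u) = Path-suffix a∈ p u

  -- If the new start already occurs on the simple path of the tail, the path is cut back to that
  -- occurrence; otherwise it is prepended.
  loop-erasure : DecidableEquality X → ∀ {a b} → Star R a b →
                 ∃ λ vs → Path a vs b × Unique (a ∷ vs)
  loop-erasure _≟_ ε = [] , [] , [] ∷ []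
  loop-erasure _≟_ {a} (_◅_ {j = c} r rs) with loop-erasure _≟_ rs
  ... | vs , p , u with DecMembership._∈?_ _≟_ a (c ∷ vs)
  ...   | yes a∈ = Path-suffix a∈ (r ∷ p) u
  ...   | no a∉  = c ∷ vs , r ∷ p , ¬Any⇒All¬ _ a∉ ∷ u

  Path-linked : {S : Rel X 0ℓ} → (∀ {a b} → R a b → S a b) →
                ∀ {a b c vs} → Path a vs b → S b c → Linked S (a ∷ vs ∷ʳ c)
  Path-linked f []      s = s ∷ [-]
  Path-linked f (r ∷ p) s = f r ∷ Path-linked f p s

module _ (G : Graph) where
  open Graph G

  Adj-sym : ∀ {u v} → Adj u v → Adj v u
  Adj-sym {u} {v} = subst T (symm u v)

  Adj⇒≢ : ∀ {u v} → Adj u v → u ≢ v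
  Adj⇒≢ {u} uv refl = subst T (irrefl u) uv

  N[]⁺ : ∀ S {v y} → ¬ T (S v) → T (S y) → Adj y v → T (N[ S ] v)
  N[]⁺ S {v} {y} v∉S y∈S yv with S v
  ... | true  = v∉S _
  ... | false = any⁺ _ (lose (complete y) (Equivalence.from T-∧ (y∈S , yv)))

  N[]⁻ : ∀ S {v} → T (N[ S ] v) → ∃ λ y → T (S y) × Adj y v
  N[]⁻ S {v} p with S v
  ... | false with satisfied (any⁻ _ elements p)
  ...   | y , q = y , Equivalence.to T-∧ q

  -- The edge from `d` to a third vertex must contain `c`. Three vertices are what rules out a
  -- single edge, both of whose ends would be centres.
  IsStarCentre-unique : ∀ {c d} → IsStarCentre G c → IsStarCentre G d → c ≡ d
  IsStarCentre-unique {c} {d} (≥3 , _ , centre) (_ , adj-d , _) with c ≟ d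
  ... | yes c≡d = c≡d
  ... | no c≢d with atLeast3⇒∃≢ _≟_ ≥3 c
  ...   | a , b , a≢c , b≢c , a≢b with a ≟ d
  ...     | no a≢d = case centre _ _ (adj-d a a≢d) of λ
              { (inj₁ d≡c) → sym d≡c ; (inj₂ a≡c) → contradiction a≡c a≢c }
  ...     | yes refl = case centre _ _ (adj-d b (≢-sym a≢b)) of λ
              { (inj₁ d≡c) → sym d≡c ; (inj₂ b≡c) → contradiction b≡c b≢c }

  clique-not-star : IsClique G → ¬ IsStar G
  clique-not-star clique (c , ≥3 , _ , centre) with atLeast3⇒∃≢ _≟_ ≥3 c
  ... | a , b , a≢c , b≢c , a≢b = [ a≢c , b≢c ]′ (centre a b (clique a b a≢b))

  -- Labels of a reduced tree, prime ones included, have no isolated vertex. Hence a walk along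
  -- label-edges never gets stuck inside a node.
  degenerate-neighbour : AtLeast 3 Vertex → IsPrime G ⊎ IsDegenerate G → ∀ v → ∃ (Adj v)
  degenerate-neighbour ≥3 kind v with atLeast3⇒∃≢ _≟_ ≥3 v
  degenerate-neighbour ≥3 (inj₁ (conn , _)) v | a , _ , a≢v , _ with conn v a
  ... | ε      = contradiction refl a≢v
  ... | va ◅ _ = _ , va
  degenerate-neighbour ≥3 (inj₂ (inj₁ clique)) v | a , _ , a≢v , _ = a , clique v a (≢-sym a≢v)
  degenerate-neighbour ≥3 (inj₂ (inj₂ (c , _ , adj-c , centre))) v | a , _ , a≢v , _ with v ≟ c
  ... | yes refl = a , adj-c a a≢v
  ... | no v≢c   = c , Adj-sym (adj-c v v≢c)

-- Non-backtracking walks and the two sides of a tree-edge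

module Walks {Leaf : Set} (τ : GLT Leaf) where
  open GLT τ public

  Elt : Set
  Elt = Element Leaf label

  -- After crossing `p` the walk either stops or, having entered a node at `r`, moves by `R` to `r′`
  -- and crosses that marker. Leaving `R` open lets both kinds of walk share the transfer lemmas for
  -- node-split and subdivision.
  data Beyond (R : ∀ v → Rel (Graph.Vertex (label v)) 0ℓ) : Elt → TreeVertex → Set where
    stop : ∀ {p a} → end (opposite p) ≡ a → Beyond R p a
    go   : ∀ {p a v r r′} → opposite p ≡ marker v r → R v r r′ →
           Beyond R (marker v r′) a → Beyond R p a

  -- The ends of the non-backtracking walks in the tree which start by
  -- crossing p; for Out the walks in addition follow label-edges.
  Past Out : Elt → TreeVertex → Set
  Past = Beyond (λ _ → _≢_)
  Out  = Beyond (λ v → Graph.Adj (label v))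

  Out⊆Past : ∀ {p a} → Out p a → Past p a
  Out⊆Past (stop e)      = stop e
  Out⊆Past (go {v = v} e rr′ o) = go e (Adj⇒≢ (label v) rr′) (Out⊆Past o)

  end-leaf : ∀ {p ℓ} → end p ≡ inj₁ ℓ → p ≡ leaf ℓ
  end-leaf {leaf _} refl = refl

  same-end : ∀ p r → end p ≡ end r → p ≢ r →
             ∃ λ v → ∃₂ λ q q′ → p ≡ marker v q × r ≡ marker v q′ × q ≢ q′
  same-end (leaf ℓ) (leaf _) refl p≢r = contradiction refl p≢r
  same-end (marker v q) (marker _ q′) refl p≢r = v , q , q′ , refl , refl , λ { refl → p≢r refl }

  _≟ⱽ_ : DecidableEquality TreeVertex
  _≟ⱽ_ = ⊎-≡-dec (Finite._≟_ leaves) (Finite._≟_ nodes)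

  without-flip : ∀ {p a b} → TreeAdjWithout p a b → opposite (opposite p) ≡ p →
                 TreeAdjWithout (opposite p) a b
  without-flip (s , s≢p , s≢op , e) inv = s , s≢op , (λ s≡oop → s≢p (trans s≡oop inv)) , e

  -- Stated before acyclicity is available, because acyclicity of the split and of the subdivided
  -- tree is derived from these facts.
  module Involutive (involutive : ∀ q → opposite (opposite q) ≡ q) where

    opposite-injective : ∀ {p r} → opposite p ≡ opposite r → p ≡ r
    opposite-injective {p} {r} e = trans (sym (involutive p)) (trans (cong opposite e) (involutive r))

    opposite-swap : ∀ {p r} → opposite p ≡ r → p ≡ opposite r
    opposite-swap {p} e = trans (sym (involutive p)) (cong opposite e)

    end-opposite² : ∀ p → end (opposite (opposite p)) ≡ end p
    end-opposite² p = cong end (involutive p)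

    TreeAdj-sym : ∀ {a b} → TreeAdj a b → TreeAdj b a
    TreeAdj-sym (s , refl , refl) = opposite s , refl , end-opposite² s

    without-sym : ∀ {p a b} → TreeAdjWithout p a b → TreeAdjWithout p b a
    without-sym (s , s≢p , s≢op , refl , refl) =
      opposite s , (λ e → s≢op (opposite-swap e)) , (λ e → s≢p (opposite-injective e)) ,
      refl , end-opposite² s

    -- The induction hypothesis for the tail concerns the deletion of the next edge `marker v r′`
    -- instead of `p`. If the new step uses that very edge, it ends at one of its two ends, and a
    -- shorter walk reaches either of them.
    past-step : ∀ {p a b} → Past p a → TreeAdjWithout p a b → Past p b
    past-step {p} (stop refl) (s , _ , s≢op , es , refl)
      with same-end (opposite p) s (sym es) (≢-sym s≢op)
    ... | v , r , r′ , op≡ , refl , r≢r′ = go op≡ r≢r′ (stop refl)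
    past-step {p} (go {v = v} {r′ = r′} op≡ r≢r′ b) w@(s , _ , _ , es , refl)
      with s ≟ᴱ marker v r′ | s ≟ᴱ opposite (marker v r′)
    ... | yes refl | _        = go op≡ r≢r′ (stop refl)
    ... | no _     | yes refl = stop (trans (cong end op≡) (sym (end-opposite² (marker v r′))))
    ... | no s≢    | no s≢o   = go op≡ r≢r′ (past-step b (s , s≢ , s≢o , es , refl))

    past-closed : ∀ {p a b} → Past p a → Star (TreeAdjWithout p) a b → Past p b
    past-closed {p} = Star-closed (Past p) past-step

    -- Deleting the first edge `p` of a cycle leaves a walk between its ends. Followed in one
    -- direction it returns to the start of `p` after crossing `p`, and in the other to the start of
    -- `opposite p` after crossing that. Excluding one return therefore suffices, and the choice may
    -- depend on `p`.
    separated⇒acyclic :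
      (∀ p → ¬ Past p (end p) ⊎ ¬ Past (opposite p) (end (opposite p))) → ¬ Cycle TreeAdj
    separated⇒acyclic no-return (v , _ ∷ [] , s≤s () , _)
    separated⇒acyclic no-return (v , w₁ ∷ w₂ ∷ ws , _ , (v≢w₁ ∷ v≢w₂ ∷ v≢ws) ∷ (w₁≢ ∷ _)
                                  , (p , refl , refl) ∷ w₁w₂ ∷ rest) =
      [ (λ ¬past → ¬past (past-closed (stop refl) walk))
      , (λ ¬past → ¬past (past-closed (stop (end-opposite² p))
          (Star-map (λ s → without-flip s (involutive p)) (reverse (without-sym {p}) walk)))) ]′
      (no-return p)
      where
      avoid : ∀ {x} → TreeAdj w₁ x → v ≢ x → TreeAdjWithout p w₁ x
      avoid (s , es , refl) v≢x = s , (λ { refl → v≢w₁ es })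
        , (λ { refl → v≢x (sym (end-opposite² p)) }) , es , refl

      tail : ∀ x xs → All (v ≢_) (x ∷ xs) → All (w₁ ≢_) (x ∷ xs) →
             Linked TreeAdj (x ∷ xs ∷ʳ v) → Star (TreeAdjWithout p) x v
      tail x [] (v≢x ∷ _) (w₁≢x ∷ _) ((s , refl , es) ∷ _) =
        (s , (λ { refl → v≢x refl }) , (λ { refl → w₁≢x refl }) , refl , es) ◅ ε
      tail x (y ∷ xs) (v≢x ∷ v≢) (w₁≢x ∷ w₁≢) ((s , refl , es) ∷ l) =
        (s , (λ { refl → v≢x refl }) , (λ { refl → w₁≢x refl }) , refl , es) ◅ tail y xs v≢ w₁≢ l

      walk : Star (TreeAdjWithout p) w₁ v
      walk = avoid w₁w₂ v≢w₂ ◅ tail w₂ ws (v≢w₂ ∷ v≢ws) w₁≢ rest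

    -- List reversal with an accumulator: the second walk is the part already reversed. Label-edges
    -- are turned round by symmetry of adjacency.
    out-reverse : ∀ {p m a} → Out p (inj₁ m) → Out (opposite p) a → Out (leaf m) a
    out-reverse {p} (stop e) o = subst (λ q → Out q _) (end-leaf e) o
    out-reverse {p} (go {v = v} {r} {r′} op≡ rr′ b) o =
      out-reverse b (go (involutive (marker v r′)) (Adj-sym (label v) rr′) (subst (λ q → Out q _) op≡ o))

    -- Crossing the opposite of a marker of `v` enters `v` itself, so a walk to a leaf must leave
    -- through some other marker. This is how the state of an opposite is computed from the states
    -- at `v`.
    around : ∀ {R v q m} → Beyond R (opposite (marker v q)) (inj₁ m) →
             ∃ λ r → R v q r × Beyond R (marker v r) (inj₁ m)
    around {v = v} {q} (stop e) = case trans (sym (end-opposite² (marker v q))) e of λ ()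
    around {v = v} {q} (go oop≡ rr′ b) with trans (sym oop≡) (involutive (marker v q))
    ... | refl = _ , rr′ , b

    around⁻ : ∀ {R v q r a} → R v q r → Beyond R (marker v r) a → Beyond R (opposite (marker v q)) a
    around⁻ {v = v} {q} = go (involutive (marker v q))

  module Tree (isGLT : IsGLT τ) where
    open IsGLT isGLT public
    open Involutive involutive public

    -- A walk around `p` would, after loop erasure, close up with `p` to a cycle. Paths too short to
    -- do so would make `p` a loop or have an edge parallel to it.
    bridge : ∀ p → ¬ Star (TreeAdjWithout p) (end p) (end (opposite p))
    bridge p walk = cut (loop-erasure _≟ⱽ_ walk) refl refl
      where
      cut : ∀ {a b} → (∃ λ vs → Path {R = TreeAdjWithout p} a vs b × Unique (a ∷ vs)) →
            a ≡ end p → b ≡ end (opposite p) → ⊥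
      cut (_ , [] , _) ea eb = loop-free p (trans (sym ea) eb)
      cut (_ , (s , s≢p , _ , es , eos) ∷ [] , _) ea eb =
        s≢p (simple s p (trans es ea) (trans eos eb))
      cut (vs , path@(_ ∷ _ ∷ _) , u) refl refl =
        proj₂ tree (_ , vs , s≤s (s≤s z≤n) , u ,
          Path-linked (λ (s , _ , _ , es) → s , es) path (opposite p , refl , end-opposite² p))

    -- The tail yields a walk avoiding the next edge `s`, but it has to avoid `p` as well. Both
    -- edges meet in the node just entered, so using `p` would mean coming back to the near end of
    -- `s`, against `bridge s`.
    past⇒walk : ∀ {p a} → Past p a → Star (TreeAdjWithout p) (end (opposite p)) a
    past⇒walk (stop refl) = ε
    past⇒walk {p} (go {v = v} {r} {r′} op≡ r≢r′ b) =
      subst (λ b → Star (TreeAdjWithout p) b _) (sym ends) (first ◅ continue ε (past⇒walk b))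
      where
      s : Elt
      s = marker v r′

      ends : end (opposite p) ≡ end s
      ends = cong end op≡

      first : TreeAdjWithout p (end s) (end (opposite s))
      first = s , (λ { refl → loop-free s (sym ends) })
                , (λ e → r≢r′ (case trans (sym op≡) (sym e) of λ { refl → refl })) , refl , refl

      back : ¬ Star (TreeAdjWithout s) (end (opposite s)) (end s)
      back w = bridge s (reverse (without-sym {s}) w)

      -- The first argument keeps the part already walked from the far end of `s`; it is completed
      -- to the forbidden return as soon as a step uses `p`.
      continue : ∀ {b c} → Star (TreeAdjWithout s) (end (opposite s)) b →
                 Star (TreeAdjWithout s) b c → Star (TreeAdjWithout p) b c
      continue done ε = ε
      continue done (w@(t , _ , _ , et , eot) ◅ ws) =
        (t , (λ { refl → back (done ◅◅ (subst (TreeAdjWithout s _) (trans (sym eot) ends) w ◅ ε)) })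
           , (λ { refl → back (subst (Star (TreeAdjWithout s) _) (trans (sym et) ends) done) }) , et , eot)
        ◅ continue (done ◅◅ (w ◅ ε)) ws

    no-return : ∀ p → ¬ Past p (end p)
    no-return p past = bridge p (reverse (without-sym {p}) (past⇒walk past))

    past-opposite⇒walk : ∀ {p a} → Past (opposite p) a → Star (TreeAdjWithout p) (end p) a
    past-opposite⇒walk {p} {a} past = Star-map unflip
      (subst (λ b → Star (TreeAdjWithout (opposite p)) b a) (end-opposite² p) (past⇒walk past))
      where
      unflip : ∀ {a b} → TreeAdjWithout (opposite p) a b → TreeAdjWithout p a b
      unflip s = subst (λ q → TreeAdjWithout q _ _) (involutive p)
                   (without-flip s (involutive (opposite p)))

    past-disjoint : ∀ {p a} → Past p a → ¬ Past (opposite p) a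
    past-disjoint {p} past past′ =
      bridge p (past-opposite⇒walk past′ ◅◅ reverse (without-sym {p}) (past⇒walk past))

    past-total : ∀ p a → Past p a ⊎ Past (opposite p) a
    past-total p a = Star-closed (λ a → Past p a ⊎ Past (opposite p) a) step
                       (inj₂ (stop (end-opposite² p))) (proj₁ tree (end p) a)
      where
      step : ∀ {a b} → Past p a ⊎ Past (opposite p) a → TreeAdj a b → Past p b ⊎ Past (opposite p) b
      step past (s , refl , refl) with s ≟ᴱ p | s ≟ᴱ opposite p
      ... | yes refl | _        = inj₁ (stop refl)
      ... | no _     | yes refl = inj₂ (stop refl)
      ... | no s≢p   | no s≢op  with past
      ...   | inj₁ past₁ = inj₁ (past-step past₁ (s , s≢p , s≢op , refl , refl))
      ...   | inj₂ past₂ = inj₂ (past-step past₂ (without-flip (s , s≢p , s≢op , refl , refl) (involutive p)))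

    -- `L` is defined by what fails: coinciding with a leaf, or being reached without the edge.
    -- Since every tree vertex lies on one of the two sides, excluding one side produces a walk on
    -- the other.
    L⇒Past : ∀ {p m} → L τ p m → Past p (inj₁ m)
    L⇒Past {leaf ℓ} {m} m≢ℓ with past-total (leaf ℓ) (inj₁ m)
    ... | inj₁ past = past
    ... | inj₂ past = ⊥-elim (go-on past)
      where
      go-on : ¬ Past (opposite (leaf ℓ)) (inj₁ m)
      go-on (stop e)      = m≢ℓ (inj₁-injective (trans (sym e) (end-opposite² (leaf ℓ))))
      go-on (go e _ _) = case trans (sym e) (involutive (leaf ℓ)) of λ ()
    L⇒Past {p@(marker v q)} {m} l with past-total p (inj₁ m)
    ... | inj₁ past = past
    ... | inj₂ past = ⊥-elim (l (past-opposite⇒walk past))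

    Past⇒L : ∀ {p m} → Past p (inj₁ m) → L τ p m
    Past⇒L {leaf ℓ} past refl = no-return (leaf ℓ) past
    Past⇒L {p@(marker v q)} past w = past-disjoint past
      (past-closed (stop (end-opposite² p)) (Star-map (λ s → without-flip s (involutive p)) w))

    Out⇒Alternating : ∀ {p m} → Out p (inj₁ m) → Alternating τ tree-edge p (leaf m)
    Out⇒Alternating {p} (stop e)       = subst (Joined τ tree-edge p) (end-leaf e) (across p) ∷ []
    Out⇒Alternating {p} (go op≡ rr′ b) =
      subst (Joined τ tree-edge p) op≡ (across p) ∷ within rr′ ∷ Out⇒Alternating b

    joined-opposite : ∀ {p o} → Joined τ tree-edge p o → opposite p ≡ o
    joined-opposite (across _) = refl

    Alternating⇒Out : ∀ {p m} → Alternating τ tree-edge p (leaf m) → p ≢ leaf m → Out p (inj₁ m)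
    Alternating⇒Out []                              p≢ = contradiction refl p≢
    Alternating⇒Out (j ∷ [])                        _  = stop (cong end (joined-opposite j))
    Alternating⇒Out (j ∷ within rr′ ∷ w)            _  =
      go (joined-opposite j) rr′ (Alternating⇒Out w λ ())

    Accessible⇒Out : ∀ {ℓ m} → ℓ ≢ m → Accessible τ (leaf ℓ) (leaf m) → Out (leaf ℓ) (inj₁ m)
    Accessible⇒Out ℓ≢m (tree-edge , w) = Alternating⇒Out w λ { refl → ℓ≢m refl }
    Accessible⇒Out ℓ≢m (label-edge , []) = contradiction refl ℓ≢m
    Accessible⇒Out ℓ≢m (label-edge , () ∷ _)

    -- `Accessible` permits a first edge of either kind, but a first label-edge leads through
    -- another marker of the same node, hence to the wrong side of `p`.
    Acc⇒Out : ∀ {p m} → Acc τ p m → Out p (inj₁ m)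
    Acc⇒Out (l , tree-edge , w) = Alternating⇒Out w λ { refl → no-return _ (L⇒Past l) }
    Acc⇒Out (l , label-edge , []) = contradiction (L⇒Past l) (no-return _)
    Acc⇒Out (l , label-edge , within {u} qr ∷ w) =
      contradiction (around⁻ (Adj⇒≢ (label u) qr) (Out⊆Past (Alternating⇒Out w λ ())))
                    (past-disjoint (L⇒Past l))

    Out⇒Acc : ∀ {p m} → Out p (inj₁ m) → Acc τ p m
    Out⇒Acc o = Past⇒L (Out⊆Past o) , tree-edge , Out⇒Alternating o

    module _ (N : Subset Leaf) where

      perfect⁺ : ∀ {p} → (∀ {m} → T (N m) → Past p (inj₁ m) → Out p (inj₁ m)) →
                 (∀ {m} → Out p (inj₁ m) → T (N m)) → Perfect τ N p
      perfect⁺ f g = (λ (n , l) → Out⇒Acc (f n (L⇒Past l))) ,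
                     (λ a → g (Acc⇒Out a) , proj₁ a)

      perfect-N⇒Out : ∀ {p m} → Perfect τ N p → T (N m) → Past p (inj₁ m) → Out p (inj₁ m)
      perfect-N⇒Out (f , _) n past = Acc⇒Out (f (n , Past⇒L past))

      perfect-Out⇒N : ∀ {p m} → Perfect τ N p → Out p (inj₁ m) → T (N m)
      perfect-Out⇒N (_ , g) o = proj₁ (g (Out⇒Acc o))

      empty⁺ : ∀ {p} → (∀ {m} → Past p (inj₁ m) → ¬ T (N m)) → Empty τ N p
      empty⁺ f m (n , l) = f (L⇒Past l) n

      empty⁻ : ∀ {p m} → Empty τ N p → Past p (inj₁ m) → ¬ T (N m)
      empty⁻ e past n = e _ (n , Past⇒L past)

      perfect⇒nonempty : ∀ {p m} → Out p (inj₁ m) → Perfect τ N p → ¬ Empty τ N p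
      perfect⇒nonempty o perfect empty = empty⁻ empty (Out⊆Past o) (perfect-Out⇒N perfect o)

    -- Each step outwards removes a vertex from the finite set us of those
    -- which can still be met.
    out-nonempty : (∀ v r → ∃ (Graph.Adj (label v) r)) → ∀ p → ∃ λ m → Out p (inj₁ m)
    out-nonempty neighbour p = descend _ vertices ≤-refl p λ {a} _ → all a
      where
      vertices : List TreeVertex
      vertices = map inj₁ (Finite.elements leaves) ++ map inj₂ (Finite.elements nodes)
      all : ∀ a → a ∈ vertices
      all (inj₁ ℓ) = ∈-++⁺ˡ (∈-map⁺ inj₁ (Finite.complete leaves ℓ))
      all (inj₂ v) = ∈-++⁺ʳ _ (∈-map⁺ inj₂ (Finite.complete nodes v))
      descend : ∀ n us → length us ≤ n → ∀ p → (∀ {a} → Past p a → a ∈ us) → ∃ λ m → Out p (inj₁ m)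
      descend n us us≤n p ⊆us with opposite p in op≡
      ... | leaf m = m , stop (cong end op≡)
      ... | marker v r with n | neighbour v r
      ...   | zero  | _ =
        case filter-notAll (λ _ → no id) us (lose (⊆us (stop (cong end op≡))) id) of λ us≢[] →
          ⊥-elim (≤⇒≯ us≤n (≤-trans (s≤s z≤n) us≢[]))
      ...   | suc n | r′ , rr′ with descend n (filter other? us) shorter (marker v r′) still
        where
        other? : Decidable (_≢ inj₂ v)
        other? a = ¬? (a ≟ⱽ inj₂ v)
        shorter : length (filter other? us) ≤ n
        shorter = s≤s⁻¹ (≤-trans (filter-notAll other? us
          (lose (⊆us (stop (cong end op≡))) (λ ≢v → ≢v refl))) us≤n)
        still : ∀ {a} → Past (marker v r′) a → a ∈ filter other? us
        still past = ∈-filter⁺ other? (⊆us (go op≡ (Adj⇒≢ (label v) rr′) past))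
          λ { refl → no-return (marker v r′) past }
      ...     | m , o = m , go op≡ rr′ o

-- The node-split: walks, tree axioms and accessibility

module NodeSplit {Leaf : Set} (τ : GLT Leaf) (isGLT : IsGLT τ)
                 (u : GLT.Node τ) (s : Split (GLT.label τ u)) where
  open Split s using (A; B; A′; B′)
  module T = Walks τ
  module S = Walks (nodeSplit τ u s)
  open T.Tree isGLT

  private
    edgeA edgeB : S.Elt
    edgeA = splitEdgeA τ u s
    edgeB = splitEdgeB τ u s

  A-B-disjoint : ∀ {r} → T (A r) → ¬ T (B r)
  A-B-disjoint {r} r∈A r∈B with A r
  ... | true = r∈B

  A-B-cover : ∀ {r} → ¬ T (A r) → ¬ ¬ T (B r)
  A-B-cover {r} r∉A r∉B with A r
  ... | true  = r∉A _
  ... | false = r∉B _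

  -- The graph of splitElement; unlike that function it can be matched on.
  data Emb : T.Elt → S.Elt → Set where
    leaf : ∀ {ℓ} → Emb (leaf ℓ) (leaf ℓ)
    old  : ∀ {v r} .(v≢u : v ≢ u) → Emb (marker v r) (marker (old v v≢u) r)
    inA  : ∀ {r} (r∈A : T (A r)) → Emb (marker u r) (marker nodeA (just (r , r∈A)))
    inB  : ∀ {r} (r∈B : T (B r)) → Emb (marker u r) (marker nodeB (just (r , r∈B)))

  emb : ∀ p → Emb p (splitElement τ u s p)
  emb (leaf ℓ) = leaf
  emb (marker v r) with Finite._≟_ T.nodes v u
  ... | no v≢u   = old v≢u
  ... | yes refl with T? (A r) | T? (B r)
  ...   | yes r∈A | _       = inA r∈A
  ...   | no _    | yes r∈B = inB r∈B
  ...   | no r∉A  | no r∉B  = ⊥-elim (A-B-cover r∉A r∉B)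

  emb-functional : ∀ {p p₁ p₂} → Emb p p₁ → Emb p p₂ → p₁ ≡ p₂
  emb-functional leaf      leaf       = refl
  emb-functional (old _)   (old _)    = refl
  emb-functional (old v≢u) (inA _)    = ⊥-elim-irr (v≢u refl)
  emb-functional (old v≢u) (inB _)    = ⊥-elim-irr (v≢u refl)
  emb-functional (inA _)   (old v≢u)  = ⊥-elim-irr (v≢u refl)
  emb-functional (inB _)   (old v≢u)  = ⊥-elim-irr (v≢u refl)
  emb-functional (inA a)   (inA a′)   = cong (λ x → marker nodeA (just (_ , x))) (T-irrelevant a a′)
  emb-functional (inB b)   (inB b′)   = cong (λ x → marker nodeB (just (_ , x))) (T-irrelevant b b′)
  emb-functional (inA a)   (inB b)    = contradiction b (A-B-disjoint a)
  emb-functional (inB b)   (inA a)    = contradiction b (A-B-disjoint a)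

  emb-opposite : ∀ {p p′} → Emb p p′ → Emb (T.opposite p) (S.opposite p′)
  emb-opposite leaf    = emb _
  emb-opposite (old _) = emb _
  emb-opposite (inA _) = emb _
  emb-opposite (inB _) = emb _

  data View : S.Elt → Set where
    embedded : ∀ {p p′} → Emb p p′ → View p′
    isEdgeA  : View edgeA
    isEdgeB  : View edgeB

  view : ∀ p′ → View p′
  view (leaf ℓ)                      = embedded leaf
  view (marker (old v v≢u) r)        = embedded (old v≢u)
  view (marker nodeA (just (r , a))) = embedded (inA a)
  view (marker nodeA nothing)        = isEdgeA
  view (marker nodeB (just (r , b))) = embedded (inB b)
  view (marker nodeB nothing)        = isEdgeB

  contract : SplitNode u → T.Node
  contract (old v _) = v
  contract nodeA     = u
  contract nodeB     = u

  contractV : S.TreeVertex → T.TreeVertex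
  contractV (inj₁ ℓ) = inj₁ ℓ
  contractV (inj₂ v) = inj₂ (contract v)

  emb-end : ∀ {p p′} → Emb p p′ → T.end p ≡ contractV (S.end p′)
  emb-end leaf    = refl
  emb-end (old _) = refl
  emb-end (inA _) = refl
  emb-end (inB _) = refl

  emb-end-leaf : ∀ {p p′ m} → Emb p p′ → T.end p ≡ inj₁ m → S.end p′ ≡ inj₁ m
  emb-end-leaf leaf refl = refl

  -- What walks need in order to survive the split. A step between markers of `u` on different sides
  -- corresponds to a pair of steps, one to the new edge and one away from it; the `AB` and `BA`
  -- fields compose and decompose such pairs.
  record Compatible (R  : ∀ v → Rel (Graph.Vertex (T.label v)) 0ℓ)
                    (R₁ : ∀ v → Rel (Graph.Vertex (S.label v)) 0ℓ) : Set where
    field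
      old⇒  : ∀ {v r r′} .{v≢u : v ≢ u} → R₁ (old v v≢u) r r′ → R v r r′
      old⇐  : ∀ {v r r′} .{v≢u : v ≢ u} → R v r r′ → R₁ (old v v≢u) r r′
      A⇒    : ∀ {x y} → R₁ nodeA (just x) (just y) → R u (proj₁ x) (proj₁ y)
      A⇐    : ∀ {x y} → R u (proj₁ x) (proj₁ y) → R₁ nodeA (just x) (just y)
      B⇒    : ∀ {x y} → R₁ nodeB (just x) (just y) → R u (proj₁ x) (proj₁ y)
      B⇐    : ∀ {x y} → R u (proj₁ x) (proj₁ y) → R₁ nodeB (just x) (just y)
      AB⇒   : ∀ {x y} → R₁ nodeA (just x) nothing → R₁ nodeB nothing (just y) → R u (proj₁ x) (proj₁ y)
      AB⇐   : ∀ {x y} → R u (proj₁ x) (proj₁ y) → R₁ nodeA (just x) nothing × R₁ nodeB nothing (just y)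
      BA⇒   : ∀ {x y} → R₁ nodeB (just x) nothing → R₁ nodeA nothing (just y) → R u (proj₁ x) (proj₁ y)
      BA⇐   : ∀ {x y} → R u (proj₁ x) (proj₁ y) → R₁ nodeB (just x) nothing × R₁ nodeA nothing (just y)
      ¬loop : ∀ {v r} → ¬ R₁ v r r

  module Transfer {R R₁} (compatible : Compatible R R₁) where
    open Compatible compatible

    mutual
      contract-beyond : ∀ {p p′ a} → Emb p p′ → S.Beyond R₁ p′ a → T.Beyond R p (contractV a)
      contract-beyond e (S.stop refl) = T.stop (emb-end (emb-opposite e))
      contract-beyond e (S.go {r = r} {r′} op≡ rr′ b) =
        contract-go refl (subst (Emb _) op≡ (emb-opposite e)) rr′ b

      -- A step onto the new edge is read together with what follows, since only the pair has a
      -- counterpart at `u`. A walk that stops in the other half has already arrived at `u`.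
      contract-go : ∀ {p o v r r′ a} → T.opposite p ≡ o → Emb o (marker v r) → R₁ v r r′ →
                    S.Beyond R₁ (marker v r′) a → T.Beyond R p (contractV a)
      contract-go op≡ (old v≢u) rr′ b = T.go op≡ (old⇒ {v≢u = v≢u} rr′) (contract-beyond (old v≢u) b)
      contract-go {r′ = just _} op≡ (inA _) rr′ b = T.go op≡ (A⇒ rr′) (contract-beyond (inA _) b)
      contract-go {r′ = just _} op≡ (inB _) rr′ b = T.go op≡ (B⇒ rr′) (contract-beyond (inB _) b)
      contract-go {r′ = nothing} op≡ (inA _) rr′ (S.stop refl) = T.stop (cong T.end op≡)
      contract-go {r′ = nothing} op≡ (inB _) rr′ (S.stop refl) = T.stop (cong T.end op≡)
      contract-go {r′ = nothing} op≡ (inA _) rr′ (S.go {r′ = just _} refl rr″ b) =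
        T.go op≡ (AB⇒ rr′ rr″) (contract-beyond (inB _) b)
      contract-go {r′ = nothing} op≡ (inB _) rr′ (S.go {r′ = just _} refl rr″ b) =
        T.go op≡ (BA⇒ rr′ rr″) (contract-beyond (inA _) b)
      contract-go {r′ = nothing} op≡ (inA _) rr′ (S.go {r′ = nothing} refl rr″ b) = contradiction rr″ ¬loop
      contract-go {r′ = nothing} op≡ (inB _) rr′ (S.go {r′ = nothing} refl rr″ b) = contradiction rr″ ¬loop

    mutual
      -- Restricted to walks ending in leaves: `u` has two preimages, so a walk ending there would
      -- have no determined image.
      split-beyond : ∀ {p p′ m} → Emb p p′ → T.Beyond R p (inj₁ m) → S.Beyond R₁ p′ (inj₁ m)
      split-beyond e (T.stop op≡) = S.stop (emb-end-leaf (emb-opposite e) op≡)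
      split-beyond {p′ = p′} e (T.go op≡ rr′ b) =
        split-go refl (subst (λ o → Emb o (S.opposite p′)) op≡ (emb-opposite e)) (emb _) rr′ b

      split-go : ∀ {p′ o′ q v r r′ m} → S.opposite p′ ≡ o′ → Emb (marker v r) o′ → Emb (marker v r′) q →
                 R v r r′ → T.Beyond R (marker v r′) (inj₁ m) → S.Beyond R₁ p′ (inj₁ m)
      split-go op≡ (old v≢u) (old v≢u′) rr′ b = S.go op≡ (old⇐ {v≢u = v≢u} rr′) (split-beyond (old v≢u) b)
      split-go op≡ (old v≢u) (inA _)    rr′ b = ⊥-elim-irr (v≢u refl)
      split-go op≡ (old v≢u) (inB _)    rr′ b = ⊥-elim-irr (v≢u refl)
      split-go op≡ (inA _)   (old v≢u)  rr′ b = ⊥-elim-irr (v≢u refl)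
      split-go op≡ (inB _)   (old v≢u)  rr′ b = ⊥-elim-irr (v≢u refl)
      split-go op≡ (inA _)   (inA y)    rr′ b = S.go op≡ (A⇐ rr′) (split-beyond (inA y) b)
      split-go op≡ (inB _)   (inB y)    rr′ b = S.go op≡ (B⇐ rr′) (split-beyond (inB y) b)
      split-go op≡ (inA x)   (inB y)    rr′ b = case AB⇐ {_ , x} {_ , y} rr′ of λ
        (to , from) → S.go op≡ to (S.go refl from (split-beyond (inB y) b))
      split-go op≡ (inB x)   (inA y)    rr′ b = case BA⇐ {_ , x} {_ , y} rr′ of λ
        (to , from) → S.go op≡ to (S.go refl from (split-beyond (inA y) b))

    beyond-edgeA : ∀ {m} → S.Beyond R₁ edgeA (inj₁ m) →
                   ∃ λ y → R₁ nodeB nothing (just y) × T.Beyond R (marker u (proj₁ y)) (inj₁ m)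
    beyond-edgeA (S.go {r′ = just y} refl rr′ b) = y , rr′ , contract-beyond (inB _) b
    beyond-edgeA (S.go {r′ = nothing} refl rr′ b) = contradiction rr′ ¬loop

    beyond-edgeA⁻ : ∀ {m y} → R₁ nodeB nothing (just y) → T.Beyond R (marker u (proj₁ y)) (inj₁ m) →
                    S.Beyond R₁ edgeA (inj₁ m)
    beyond-edgeA⁻ rr′ b = S.go refl rr′ (split-beyond (inB _) b)

    beyond-edgeB : ∀ {m} → S.Beyond R₁ edgeB (inj₁ m) →
                   ∃ λ y → R₁ nodeA nothing (just y) × T.Beyond R (marker u (proj₁ y)) (inj₁ m)
    beyond-edgeB (S.go {r′ = just y} refl rr′ b) = y , rr′ , contract-beyond (inA _) b
    beyond-edgeB (S.go {r′ = nothing} refl rr′ b) = contradiction rr′ ¬loop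

    beyond-edgeB⁻ : ∀ {m y} → R₁ nodeA nothing (just y) → T.Beyond R (marker u (proj₁ y)) (inj₁ m) →
                    S.Beyond R₁ edgeB (inj₁ m)
    beyond-edgeB⁻ rr′ b = S.go refl rr′ (split-beyond (inA _) b)

  ≢-compatible : Compatible (λ _ → _≢_) (λ _ → _≢_)
  ≢-compatible = record
    { old⇒  = id
    ; old⇐  = id
    ; A⇒    = λ x≢y → λ { refl → x≢y (cong (just ∘ (_ ,_)) (T-irrelevant _ _)) }
    ; A⇐    = λ r≢r′ → λ { refl → r≢r′ refl }
    ; B⇒    = λ x≢y → λ { refl → x≢y (cong (just ∘ (_ ,_)) (T-irrelevant _ _)) }
    ; B⇐    = λ r≢r′ → λ { refl → r≢r′ refl }
    ; AB⇒   = λ {x} {y} _ _ → λ { refl → A-B-disjoint (proj₂ x) (proj₂ y) }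
    ; AB⇐   = λ _ → (λ ()) , λ ()
    ; BA⇒   = λ {x} {y} _ _ → λ { refl → A-B-disjoint (proj₂ y) (proj₂ x) }
    ; BA⇐   = λ _ → (λ ()) , λ ()
    ; ¬loop = λ r≢r → r≢r refl
    }

  -- Adjacency across a split means membership of both ends in the frontiers. Composing is exactly
  -- the condition `joined`, decomposing is the definition of a frontier.
  Adj-compatible : Compatible (λ v → Graph.Adj (T.label v)) (λ v → Graph.Adj (S.label v))
  Adj-compatible = record
    { old⇒  = id
    ; old⇐  = id
    ; A⇒    = id
    ; A⇐    = id
    ; B⇒    = id
    ; B⇐    = id
    ; AB⇒   = Split.joined s _ _
    ; AB⇐   = λ {x} {y} xy →
        N[]⁺ G B (A-B-disjoint (proj₂ x)) (proj₂ y) (Adj-sym G xy) ,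
        N[]⁺ G A (λ a → A-B-disjoint a (proj₂ y)) (proj₂ x) xy
    ; BA⇒   = λ x∈B′ y∈A′ → Adj-sym G (Split.joined s _ _ y∈A′ x∈B′)
    ; BA⇐   = λ {x} {y} xy →
        N[]⁺ G A (λ a → A-B-disjoint a (proj₂ x)) (proj₂ y) (Adj-sym G xy) ,
        N[]⁺ G B (A-B-disjoint (proj₂ y)) (proj₂ x) xy
    ; ¬loop = λ {v} rr → Adj⇒≢ (S.label v) rr refl
    }
    where
    G : Graph
    G = T.label u

  module PastTransfer = Transfer ≢-compatible
  module OutTransfer  = Transfer Adj-compatible

  split-involutive : ∀ p′ → S.opposite (S.opposite p′) ≡ p′
  split-involutive p′ with view p′
  ... | embedded e = emb-functional (subst (λ p → Emb p _) (involutive _) (emb-opposite (emb-opposite e))) e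
  ... | isEdgeA = refl
  ... | isEdgeB = refl

  split-loop-free : ∀ p′ → S.end p′ ≢ S.end (S.opposite p′)
  split-loop-free p′ with view p′
  ... | embedded e = λ eq → loop-free _
          (trans (emb-end e) (trans (cong contractV eq) (sym (emb-end (emb-opposite e)))))
  ... | isEdgeA = λ ()
  ... | isEdgeB = λ ()

  -- An old edge parallel to the new one would contract to a loop at `u`; two old edges are compared
  -- after contraction.
  split-simple : ∀ p r → S.end p ≡ S.end r → S.end (S.opposite p) ≡ S.end (S.opposite r) → p ≡ r
  split-simple p r e e′ with view p | view r
  ... | isEdgeA | isEdgeA = refl
  ... | isEdgeB | isEdgeB = refl
  ... | isEdgeA | isEdgeB = case e of λ ()
  ... | isEdgeB | isEdgeA = case e of λ ()
  ... | embedded p↦ | embedded r↦ = emb-functional p↦ (subst (λ q → Emb q r) (sym (simple _ _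
          (trans (emb-end p↦) (trans (cong contractV e) (sym (emb-end r↦))))
          (trans (emb-end (emb-opposite p↦)) (trans (cong contractV e′) (sym (emb-end (emb-opposite r↦))))))) r↦)
  ... | embedded p↦ | isEdgeA = contradiction (trans (emb-end p↦) (trans (cong contractV e)
          (sym (trans (emb-end (emb-opposite p↦)) (cong contractV e′))))) (loop-free _)
  ... | embedded p↦ | isEdgeB = contradiction (trans (emb-end p↦) (trans (cong contractV e)
          (sym (trans (emb-end (emb-opposite p↦)) (cong contractV e′))))) (loop-free _)
  ... | isEdgeA | embedded r↦ = contradiction (trans (emb-end r↦) (trans (cong contractV (sym e))
          (sym (trans (emb-end (emb-opposite r↦)) (cong contractV (sym e′)))))) (loop-free _)
  ... | isEdgeB | embedded r↦ = contradiction (trans (emb-end r↦) (trans (cong contractV (sym e))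
          (sym (trans (emb-end (emb-opposite r↦)) (cong contractV (sym e′)))))) (loop-free _)

  -- Only the fibre over `u` has more than one vertex, and the new tree-edge connects it. Walks of
  -- the old tree are lifted edge by edge with these connections in between.
  fibre-connected : ∀ a b → contractV a ≡ contractV b → Star S.TreeAdj a b
  fibre-connected (inj₁ _) (inj₁ _) refl = ε
  fibre-connected (inj₂ (old _ _)) (inj₂ (old _ _)) refl = ε
  fibre-connected (inj₂ (old _ v≢u)) (inj₂ nodeA) refl = ⊥-elim-irr (v≢u refl)
  fibre-connected (inj₂ (old _ v≢u)) (inj₂ nodeB) refl = ⊥-elim-irr (v≢u refl)
  fibre-connected (inj₂ nodeA) (inj₂ (old _ v≢u)) refl = ⊥-elim-irr (v≢u refl)
  fibre-connected (inj₂ nodeB) (inj₂ (old _ v≢u)) refl = ⊥-elim-irr (v≢u refl)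
  fibre-connected (inj₂ nodeA) (inj₂ nodeA) _ = ε
  fibre-connected (inj₂ nodeB) (inj₂ nodeB) _ = ε
  fibre-connected (inj₂ nodeA) (inj₂ nodeB) _ = (edgeA , refl , refl) ◅ ε
  fibre-connected (inj₂ nodeB) (inj₂ nodeA) _ = (edgeB , refl , refl) ◅ ε

  split-connected : ConnectedBy S.TreeAdj
  split-connected a b = lift refl refl (proj₁ tree _ _)
    where
    lift : ∀ {c d a b} → c ≡ contractV a → d ≡ contractV b → Star T.TreeAdj c d → Star S.TreeAdj a b
    lift refl e ε = fibre-connected _ _ e
    lift refl e ((p , ep , refl) ◅ w) =
      fibre-connected _ _ (trans (sym ep) (emb-end (emb p))) ◅◅
      (splitElement τ u s p , refl , refl) ◅ lift (emb-end (emb-opposite (emb p))) e w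

  split-isGLT : IsGLT (nodeSplit τ u s)
  split-isGLT = record
    { involutive = split-involutive
    ; loop-free  = split-loop-free
    ; simple     = split-simple
    ; tree       = split-connected , S.Involutive.separated⇒acyclic split-involutive separated
    ; degree≥3   = λ { (old v _) → degree≥3 v
                     ; nodeA     → atLeast-Maybe (Split.|A|>1 s)
                     ; nodeB     → atLeast-Maybe (Split.|B|>1 s) }
    }
    where
    embedded-no-return : ∀ {p p′} → Emb p p′ → ¬ S.Past p′ (S.end p′)
    embedded-no-return e past = no-return _
      (subst (T.Past _) (sym (emb-end e)) (PastTransfer.contract-beyond e past))

    edgeA-no-return : ¬ S.Past edgeA (S.end edgeA)
    edgeA-no-return (S.go {r′ = nothing} refl r≢r _) = r≢r refl
    edgeA-no-return (S.go {r′ = just _} refl _ b) = no-return _ (PastTransfer.contract-beyond (inB _) b)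

    separated : ∀ p → ¬ S.Past p (S.end p) ⊎ ¬ S.Past (S.opposite p) (S.end (S.opposite p))
    separated p with view p
    ... | embedded e = inj₁ (embedded-no-return e)
    ... | isEdgeA = inj₁ edgeA-no-return
    ... | isEdgeB = inj₂ edgeA-no-return

-- Subdividing a tree-edge: walks and tree axioms

ternaryGraph : GraphOn Ternary → Graph
ternaryGraph W = record { Vertex = Ternary ; finite = ternary-finite ; graphOn = W }

ternary≥3 : AtLeast 3 Ternary
ternary≥3 = mk↣ {to = to} injective
  where
  to : Fin 3 → Ternary
  to zero             = opp-q
  to (suc zero)       = opp-q′
  to (suc (suc zero)) = opp-x

  injective : ∀ {i j} → to i ≡ to j → i ≡ j
  injective {zero}           {zero}           _ = refl
  injective {suc zero}       {suc zero}       _ = refl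
  injective {suc (suc zero)} {suc (suc zero)} _ = refl
  injective {zero}           {suc zero}       ()
  injective {zero}           {suc (suc zero)} ()
  injective {suc zero}       {suc (suc zero)} ()

module Subdivide {Leaf : Set} (τ : GLT Leaf) (isGLT : IsGLT τ)
                 (q : Element Leaf (GLT.label τ)) (W : GraphOn Ternary) where
  module T = Walks τ
  module S = Walks (subdivide τ q W)
  open T.Tree isGLT
  open GraphOn W using (adj)

  private
    q′ : T.Elt
    q′ = T.opposite q

    keep′ : T.Elt → S.Elt
    keep′ = keep τ q W

    w : Ternary → S.Elt
    w = marker nothing

  wLabel : Graph
  wLabel = ternaryGraph W

  keepV : T.TreeVertex → S.TreeVertex
  keepV (inj₁ ℓ) = inj₁ (just ℓ)
  keepV (inj₂ v) = inj₂ (just v)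

  keepV-injective : ∀ {a b} → keepV a ≡ keepV b → a ≡ b
  keepV-injective {inj₁ _} {inj₁ _} refl = refl
  keepV-injective {inj₂ _} {inj₂ _} refl = refl

  keepV≢w : ∀ {a} → keepV a ≢ inj₂ nothing
  keepV≢w {inj₁ _} ()
  keepV≢w {inj₂ _} ()

  keepV≢x : ∀ {a} → keepV a ≢ inj₁ nothing
  keepV≢x {inj₁ _} ()
  keepV≢x {inj₂ _} ()

  end-keep : ∀ p → S.end (keep′ p) ≡ keepV (T.end p)
  end-keep (leaf _)     = refl
  end-keep (marker _ _) = refl

  keep-marker : ∀ {p v r} → keep′ p ≡ marker (just v) r → p ≡ marker v r
  keep-marker {marker _ _} refl = refl

  opposite-keep : ∀ p → S.opposite (keep′ p) ≡ oppositeOfOld τ q W p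
  opposite-keep (leaf _)     = refl
  opposite-keep (marker _ _) = refl

  opposite-keep-q : S.opposite (keep′ q) ≡ w opp-q
  opposite-keep-q = trans (opposite-keep q) eq
    where
    eq : oppositeOfOld τ q W q ≡ w opp-q
    eq with q T.≟ᴱ q | q T.≟ᴱ T.opposite q
    ... | yes _  | _ = refl
    ... | no q≢q | _ = contradiction refl q≢q

  opposite-keep-q′ : S.opposite (keep′ q′) ≡ w opp-q′
  opposite-keep-q′ = trans (opposite-keep q′) eq
    where
    eq : oppositeOfOld τ q W q′ ≡ w opp-q′
    eq with q′ T.≟ᴱ q | q′ T.≟ᴱ T.opposite q
    ... | yes q′≡q | _        = contradiction (cong T.end (sym q′≡q)) (loop-free q)
    ... | no _     | yes _    = refl
    ... | no _     | no q′≢q′ = contradiction refl q′≢q′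

  opposite-keep-other : ∀ {p} → p ≢ q → p ≢ q′ → S.opposite (keep′ p) ≡ keep′ (T.opposite p)
  opposite-keep-other {p} p≢q p≢q′ = trans (opposite-keep p) eq
    where
    eq : oppositeOfOld τ q W p ≡ keep′ (T.opposite p)
    eq with p T.≟ᴱ q | p T.≟ᴱ T.opposite q
    ... | yes p≡q | _        = contradiction p≡q p≢q
    ... | no _    | yes p≡q′ = contradiction p≡q′ p≢q′
    ... | no _    | no _     = refl

  data OldView : T.Elt → Set where
    is-q  : OldView q
    is-q′ : OldView q′
    is-other : ∀ {p} → p ≢ q → p ≢ q′ → OldView p

  oldView : ∀ p → OldView p
  oldView p with p T.≟ᴱ q | p T.≟ᴱ q′
  ... | yes refl | _        = is-q
  ... | no _     | yes refl = is-q′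
  ... | no p≢q   | no p≢q′  = is-other p≢q p≢q′

  data View : S.Elt → Set where
    kept : ∀ p → View (keep′ p)
    ofW  : ∀ i → View (w i)
    ofX  : View (leaf nothing)

  view : ∀ p → View p
  view (leaf (just ℓ))     = kept (leaf ℓ)
  view (leaf nothing)      = ofX
  view (marker (just v) r) = kept (marker v r)
  view (marker nothing i)  = ofW i

  subdivide-involutive : ∀ p → S.opposite (S.opposite p) ≡ p
  subdivide-involutive p with view p
  ... | ofX        = refl
  ... | ofW opp-q  = opposite-keep-q
  ... | ofW opp-q′ = opposite-keep-q′
  ... | ofW opp-x  = refl
  ... | kept p with oldView p
  ...   | is-q  = cong S.opposite opposite-keep-q
  ...   | is-q′ = cong S.opposite opposite-keep-q′
  ...   | is-other p≢q p≢q′ = trans (cong S.opposite (opposite-keep-other p≢q p≢q′))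
          (trans (opposite-keep-other (p≢q′ ∘ opposite-swap) (p≢q ∘ opposite-injective))
                 (cong keep′ (involutive p)))

  end-opposite-keep : ∀ p → S.end (S.opposite (keep′ p)) ≡ inj₂ nothing
                          ⊎ S.end (S.opposite (keep′ p)) ≡ keepV (T.end (T.opposite p))
  end-opposite-keep p with oldView p
  ... | is-q  = inj₁ (cong S.end opposite-keep-q)
  ... | is-q′ = inj₁ (cong S.end opposite-keep-q′)
  ... | is-other p≢q p≢q′ = inj₂ (trans (cong S.end (opposite-keep-other p≢q p≢q′)) (end-keep _))

  subdivide-loop-free : ∀ p → S.end p ≢ S.end (S.opposite p)
  subdivide-loop-free p with view p
  ... | ofX        = λ ()
  ... | ofW opp-q  = λ e → keepV≢w (trans (sym (end-keep q)) (sym e))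
  ... | ofW opp-q′ = λ e → keepV≢w (trans (sym (end-keep q′)) (sym e))
  ... | ofW opp-x  = λ ()
  ... | kept p with end-opposite-keep p
  ...   | inj₁ e = λ e′ → keepV≢w (trans (sym (end-keep p)) (trans e′ e))
  ...   | inj₂ e = λ e′ → loop-free p (keepV-injective (trans (sym (end-keep p)) (trans e′ e)))

  private
    endᵂ : Ternary → S.TreeVertex
    endᵂ i = S.end (S.opposite (w i))

    endᵂ-q : endᵂ opp-q ≡ keepV (T.end q)
    endᵂ-q = end-keep q

    endᵂ-q′ : endᵂ opp-q′ ≡ keepV (T.end q′)
    endᵂ-q′ = end-keep q′

    ends-distinct : S.end (keep′ q) ≢ S.end (keep′ q′)
    ends-distinct e = loop-free q (keepV-injective (trans (sym endᵂ-q) (trans e endᵂ-q′)))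

  subdivide-simple : ∀ p r → S.end p ≡ S.end r → S.end (S.opposite p) ≡ S.end (S.opposite r) → p ≡ r
  subdivide-simple p r e e′ with view p | view r
  ... | ofX    | ofX    = refl
  ... | ofX    | ofW _  = case e of λ ()
  ... | ofW _  | ofX    = case e of λ ()
  ... | ofX    | kept r = contradiction (trans (sym (end-keep r)) (sym e)) keepV≢x
  ... | kept p | ofX    = contradiction (trans (sym (end-keep p)) e) keepV≢x
  ... | ofW _  | kept r = contradiction (trans (sym (end-keep r)) (sym e)) keepV≢w
  ... | kept p | ofW _  = contradiction (trans (sym (end-keep p)) e) keepV≢w
  ... | ofW opp-q  | ofW opp-q  = refl
  ... | ofW opp-q′ | ofW opp-q′ = refl
  ... | ofW opp-x  | ofW opp-x  = refl
  ... | ofW opp-q  | ofW opp-q′ = contradiction e′ ends-distinct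
  ... | ofW opp-q′ | ofW opp-q  = contradiction (sym e′) ends-distinct
  ... | ofW opp-q  | ofW opp-x  = contradiction (trans (sym endᵂ-q) e′) keepV≢x
  ... | ofW opp-q′ | ofW opp-x  = contradiction (trans (sym endᵂ-q′) e′) keepV≢x
  ... | ofW opp-x  | ofW opp-q  = contradiction (trans (sym endᵂ-q) (sym e′)) keepV≢x
  ... | ofW opp-x  | ofW opp-q′ = contradiction (trans (sym endᵂ-q′) (sym e′)) keepV≢x
  ... | kept p | kept r with oldView p | oldView r
  ...   | is-q  | is-q  = refl
  ...   | is-q′ | is-q′ = refl
  ...   | is-q  | is-q′ = contradiction e ends-distinct
  ...   | is-q′ | is-q  = contradiction (sym e) ends-distinct
  ...   | is-other a b | is-q  = contradiction (trans (sym (end-keep _)) (trans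
            (cong S.end (sym (opposite-keep-other a b))) (trans e′ (cong S.end opposite-keep-q)))) keepV≢w
  ...   | is-other a b | is-q′ = contradiction (trans (sym (end-keep _)) (trans
            (cong S.end (sym (opposite-keep-other a b))) (trans e′ (cong S.end opposite-keep-q′)))) keepV≢w
  ...   | is-q  | is-other a b = contradiction (trans (sym (end-keep _)) (trans
            (cong S.end (sym (opposite-keep-other a b))) (trans (sym e′) (cong S.end opposite-keep-q)))) keepV≢w
  ...   | is-q′ | is-other a b = contradiction (trans (sym (end-keep _)) (trans
            (cong S.end (sym (opposite-keep-other a b))) (trans (sym e′) (cong S.end opposite-keep-q′)))) keepV≢w
  ...   | is-other a b | is-other c d = cong keep′ (simple p r
            (keepV-injective (trans (sym (end-keep p)) (trans e (end-keep r))))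
            (keepV-injective (trans (sym (end-keep _)) (trans (cong S.end (sym (opposite-keep-other a b)))
              (trans e′ (trans (cong S.end (opposite-keep-other c d)) (end-keep _)))))))

  open S.Involutive subdivide-involutive using () renaming (TreeAdj-sym to subdivide-TreeAdj-sym)

  subdivide-connected : ConnectedBy S.TreeAdj
  subdivide-connected a b = to-w a ◅◅ reverse subdivide-TreeAdj-sym (to-w b)
    where
    step : ∀ p → Star S.TreeAdj (keepV (T.end p)) (keepV (T.end (T.opposite p)))
    step p with oldView p
    ... | is-q  = (keep′ q , end-keep q , cong S.end opposite-keep-q) ◅
                  (w opp-q′ , refl , end-keep q′) ◅ ε
    ... | is-q′ = (keep′ q′ , end-keep q′ , cong S.end opposite-keep-q′) ◅
                  (w opp-q , refl , trans (end-keep q) (cong keepV (sym (end-opposite² q)))) ◅ ε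
    ... | is-other p≢q p≢q′ =
      (keep′ p , end-keep p , trans (cong S.end (opposite-keep-other p≢q p≢q′)) (end-keep _)) ◅ ε

    lift : ∀ {a b} → Star T.TreeAdj a b → Star S.TreeAdj (keepV a) (keepV b)
    lift ε                      = ε
    lift ((p , refl , refl) ◅ ps) = step p ◅◅ lift ps

    kept-to-w : ∀ a → Star S.TreeAdj (keepV a) (inj₂ nothing)
    kept-to-w a = lift (proj₁ tree a (T.end q)) ◅◅ (keep′ q , end-keep q , cong S.end opposite-keep-q) ◅ ε

    to-w : ∀ a → Star S.TreeAdj a (inj₂ nothing)
    to-w (inj₁ (just ℓ)) = kept-to-w (inj₁ ℓ)
    to-w (inj₁ nothing)  = (leaf nothing , refl , refl) ◅ ε
    to-w (inj₂ (just v)) = kept-to-w (inj₂ v)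
    to-w (inj₂ nothing)  = ε

  -- Contracting a walk requires that it cannot turn back at the new node; lifting one requires that
  -- it can pass between `opp-q` and `opp-q′`. For label-edges the latter is a condition on the
  -- label, satisfied by a clique and by a star centred at either of these two markers.
  module Transfer {R  : ∀ v → Rel (Graph.Vertex (T.label v)) 0ℓ}
                  {R₁ : ∀ v → Rel (Graph.Vertex (S.label v)) 0ℓ}
                  (old⇒ : ∀ {v r r′} → R₁ (just v) r r′ → R v r r′)
                  (old⇐ : ∀ {v r r′} → R v r r′ → R₁ (just v) r r′) where

    module _ (¬loop : ∀ {i} → ¬ R₁ nothing i i) where
      mutual
        contract-kept : ∀ p {a} → S.Beyond R₁ (keep′ p) (keepV a) → T.Beyond R p a
        contract-kept p b with oldView p
        ... | is-other p≢q p≢q′ = contract-enter refl (opposite-keep-other p≢q p≢q′) b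
        ... | is-q  = contract-through-q opposite-keep-q b
        ... | is-q′ = contract-through-q′ opposite-keep-q′ b

        -- `p₁` is whatever is crossed last before the kept element `o`: a kept extremity or a
        -- marker of the new node. Both occur, so only its opposite is prescribed.
        contract-enter : ∀ {p p₁ o a} → T.opposite p ≡ o → S.opposite p₁ ≡ keep′ o →
                         S.Beyond R₁ p₁ (keepV a) → T.Beyond R p a
        contract-enter {o = o} op≡ e (S.stop e′) = S-stop (trans (sym e′) (trans (cong S.end e) (end-keep o)))
          where
          S-stop : ∀ {a} → keepV a ≡ keepV (T.end o) → T.Beyond R _ a
          S-stop eq = T.stop (trans (cong T.end op≡) (sym (keepV-injective eq)))
        contract-enter op≡ e (S.go {v = just v} {r′ = r′} e′ rr′ b) =
          T.go (trans op≡ (keep-marker (trans (sym e) e′))) (old⇒ rr′) (contract-kept (marker v r′) b)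
        contract-enter {o = leaf _}     op≡ e (S.go {v = nothing} e′ rr′ b) = case trans (sym e) e′ of λ ()
        contract-enter {o = marker _ _} op≡ e (S.go {v = nothing} e′ rr′ b) = case trans (sym e) e′ of λ ()

        contract-through-q : ∀ {p₁ a} → S.opposite p₁ ≡ w opp-q → S.Beyond R₁ p₁ (keepV a) → T.Beyond R q a
        contract-through-q e (S.stop e′) = contradiction (trans (sym e′) (cong S.end e)) keepV≢w
        contract-through-q e (S.go {r′ = r′} e′ rr′ b) with trans (sym e) e′
        contract-through-q e (S.go {r′ = opp-q}  e′ rr′ b) | refl = contradiction rr′ ¬loop
        contract-through-q e (S.go {r′ = opp-q′} e′ rr′ b) | refl = contract-enter refl refl b
        contract-through-q e (S.go {r′ = opp-x}  e′ rr′ b) | refl = contract-x b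

        contract-through-q′ : ∀ {p₁ a} → S.opposite p₁ ≡ w opp-q′ → S.Beyond R₁ p₁ (keepV a) → T.Beyond R q′ a
        contract-through-q′ e (S.stop e′) = contradiction (trans (sym e′) (cong S.end e)) keepV≢w
        contract-through-q′ e (S.go {r′ = r′} e′ rr′ b) with trans (sym e) e′
        contract-through-q′ e (S.go {r′ = opp-q}  e′ rr′ b) | refl = contract-enter (involutive q) refl b
        contract-through-q′ e (S.go {r′ = opp-q′} e′ rr′ b) | refl = contradiction rr′ ¬loop
        contract-through-q′ e (S.go {r′ = opp-x}  e′ rr′ b) | refl = contract-x b

        contract-x : ∀ {p a} → S.Beyond R₁ (w opp-x) (keepV a) → T.Beyond R p a
        contract-x (S.stop e)    = contradiction (sym e) keepV≢x

    module _ (q-q′ : R₁ nothing opp-q opp-q′) (q′-q : R₁ nothing opp-q′ opp-q) where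
      mutual
        lift-kept : ∀ p {a} → T.Beyond R p a → S.Beyond R₁ (keep′ p) (keepV a)
        lift-kept p b with oldView p
        ... | is-other p≢q p≢q′ = lift-enter (opposite-keep-other p≢q p≢q′) b
        ... | is-q  = S.go opposite-keep-q q-q′ (lift-enter refl b)
        ... | is-q′ = S.go opposite-keep-q′ q′-q (lift-enter (cong keep′ (sym (involutive q))) b)

        lift-enter : ∀ {p p₁ a} → S.opposite p₁ ≡ keep′ (T.opposite p) → T.Beyond R p a → S.Beyond R₁ p₁ (keepV a)
        lift-enter e (T.stop refl) = S.stop (trans (cong S.end e) (end-keep _))
        lift-enter e (T.go {v = v} {r′ = r′} op≡ rr′ b) =
          S.go (trans e (cong keep′ op≡)) (old⇐ rr′) (lift-kept (marker v r′) b)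

  subdivide-isGLT : IsGLT (subdivide τ q W)
  subdivide-isGLT = record
    { involutive = subdivide-involutive
    ; loop-free  = subdivide-loop-free
    ; simple     = subdivide-simple
    ; tree       = subdivide-connected , S.Involutive.separated⇒acyclic subdivide-involutive separated
    ; degree≥3   = λ { (just v) → degree≥3 v ; nothing → ternary≥3 }
    }
    where
    open Transfer {R = λ _ → _≢_} {R₁ = λ _ → _≢_} id id

    kept-no-return : ∀ p → ¬ S.Past (keep′ p) (S.end (keep′ p))
    kept-no-return p past = no-return p
      (contract-kept (λ i≢i → i≢i refl) p (subst (S.Past (keep′ p)) (end-keep p) past))

    opp-x-no-return : ¬ S.Past (w opp-x) (inj₂ nothing)
    opp-x-no-return (S.stop ())

    separated : ∀ p → ¬ S.Past p (S.end p) ⊎ ¬ S.Past (S.opposite p) (S.end (S.opposite p))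
    separated p with view p
    ... | kept p     = inj₁ (kept-no-return p)
    ... | ofW opp-q  = inj₂ (kept-no-return q)
    ... | ofW opp-q′ = inj₂ (kept-no-return q′)
    ... | ofW opp-x  = inj₁ opp-x-no-return
    ... | ofX        = inj₂ opp-x-no-return

  module OutTransfer where
    private
      module Tr = Transfer {R = λ v → Graph.Adj (T.label v)} {R₁ = λ v → Graph.Adj (S.label v)} id id

      irreflexive : ∀ {i} → ¬ T (adj i i)
      irreflexive ii = Adj⇒≢ wLabel ii refl

    -- Leaving the new node through `opp-q` enters the end of `q`, which in the old tree is reached
    -- by crossing the opposite of `q`. This is why the extremities appear exchanged.
    out-x⁻ : ∀ {m} → S.Out (leaf nothing) (inj₁ (just m)) →
             (T (adj opp-x opp-q) × T.Out q′ (inj₁ m)) ⊎ (T (adj opp-x opp-q′) × T.Out q (inj₁ m))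
    out-x⁻ (S.go {r′ = opp-q}  refl xi b) = inj₁ (xi , Tr.contract-enter irreflexive (involutive q) refl b)
    out-x⁻ (S.go {r′ = opp-q′} refl xi b) = inj₂ (xi , Tr.contract-enter irreflexive refl refl b)
    out-x⁻ (S.go {r′ = opp-x}  refl xi b) = contradiction xi irreflexive

    module _ (qq′ : T (adj opp-q opp-q′)) where
      private
        q′q : T (adj opp-q′ opp-q)
        q′q = Adj-sym wLabel qq′

      out-kept : ∀ {p m} → T.Out p (inj₁ m) → S.Out (keep′ p) (inj₁ (just m))
      out-kept = Tr.lift-kept qq′ q′q _

      out-kept⁻ : ∀ {p m} → S.Out (keep′ p) (inj₁ (just m)) → T.Out p (inj₁ m)
      out-kept⁻ = Tr.contract-kept irreflexive _

      out-x : ∀ {m} → (T (adj opp-x opp-q) × T.Out q′ (inj₁ m)) ⊎ (T (adj opp-x opp-q′) × T.Out q (inj₁ m)) →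
              S.Out (leaf nothing) (inj₁ (just m))
      out-x (inj₁ (xq , o))  = S.go refl xq (Tr.lift-enter qq′ q′q (cong keep′ (sym (involutive q))) o)
      out-x (inj₂ (xq′ , o)) = S.go refl xq′ (Tr.lift-enter qq′ q′q refl o)

-- Joins of adjacent nodes

record JoinFree (G : Graph) (q : Graph.Vertex G) (H : Graph) (r : Graph.Vertex H) : Set where
  constructor excluding
  field
    no-clique-join : ¬ (IsClique G × IsClique H)
    no-star-join   : ¬ (IsStar G × IsStar H ×
      ( (IsStarCentre G q × ¬ IsStarCentre H r)
      ⊎ (¬ IsStarCentre G q × IsStarCentre H r)))

joinFree-sym : ∀ {G q H r} → JoinFree G q H r → JoinFree H r G q
joinFree-sym (excluding ¬cliques ¬stars) = excluding
  (λ (g , h) → ¬cliques (h , g))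
  λ { (g , h , inj₁ (c , ¬c)) → ¬stars (h , g , inj₂ (¬c , c))
    ; (g , h , inj₂ (¬c , c)) → ¬stars (h , g , inj₁ (c , ¬c)) }

joinFree-clique-star : ∀ {G q H r} → IsClique G → IsStar H → JoinFree G q H r
joinFree-clique-star {G} {H = H} clique star = excluding
  (λ (_ , clique′) → clique-not-star H clique′ star)
  (λ (star′ , _) → clique-not-star G clique star′)

joinFree-stars : ∀ {G q H r} → IsStar G →
                 (IsStarCentre G q → IsStarCentre H r) → (IsStarCentre H r → IsStarCentre G q) →
                 JoinFree G q H r
joinFree-stars {G} star to from = excluding
  (λ (clique , _) → clique-not-star G clique star)
  λ { (_ , _ , inj₁ (c , ¬c)) → ¬c (to c) ; (_ , _ , inj₂ (¬c , c)) → ¬c (from c) }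

-- (G₁ , q₁) takes part in no join from which (G , q) is excluded.
record Refines (G₁ : Graph) (q₁ : Graph.Vertex G₁) (G : Graph) (q : Graph.Vertex G) : Set where
  field
    clique  : IsClique G₁ → IsClique G
    star    : IsStar G₁ → IsStar G
    centre⇒ : IsStarCentre G₁ q₁ → IsStarCentre G q
    centre⇐ : IsStarCentre G q → IsStarCentre G₁ q₁

refines-refl : ∀ {G q} → Refines G q G q
refines-refl = record { clique = id ; star = id ; centre⇒ = id ; centre⇐ = id }

joinFree-refines : ∀ {G₁ q₁ G q H₁ r₁ H r} → Refines G₁ q₁ G q → Refines H₁ r₁ H r →
                   JoinFree G q H r → JoinFree G₁ q₁ H₁ r₁
joinFree-refines g h (excluding ¬cliques ¬stars) = excluding
  (λ (c , c′) → ¬cliques (G.clique c , H.clique c′))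
  λ { (s , s′ , inj₁ (c , ¬c)) → ¬stars (G.star s , H.star s′ , inj₁ (G.centre⇒ c , ¬c ∘ H.centre⇐))
    ; (s , s′ , inj₂ (¬c , c)) → ¬stars (G.star s , H.star s′ , inj₂ (¬c ∘ G.centre⇐ , H.centre⇒ c)) }
  where
  module G = Refines g
  module H = Refines h

module _ {Leaf : Set} (τ : GLT Leaf) (isGLT : IsGLT τ)
         (u : GLT.Node τ) (s : Split (GLT.label τ u)) where
  open NodeSplit τ isGLT u s
  open Split s using (A; B)

  nodeSplit-joinFree :
    IsReduced τ →
    (∀ {r} (r∈A : T (A r)) → Refines (S.label nodeA) (just (r , r∈A)) (T.label u) r) →
    (∀ {r} (r∈B : T (B r)) → Refines (S.label nodeB) (just (r , r∈B)) (T.label u) r) →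
    ∀ {n x n′ x′} → marker n x ≢ splitEdgeA τ u s → marker n x ≢ splitEdgeB τ u s →
    S.opposite (marker n x) ≡ marker n′ x′ → JoinFree (S.label n) x (S.label n′) x′
  nodeSplit-joinFree (_ , joins) refinesA refinesB {n} {x} ≢A ≢B op≡ with view (marker n x)
  ... | isEdgeA = contradiction refl ≢A
  ... | isEdgeB = contradiction refl ≢B
  ... | embedded e = old-edge e (subst (Emb _) op≡ (emb-opposite e)) refl
    where
    refines : ∀ {v r n x} → Emb (marker v r) (marker n x) → Refines (S.label n) x (T.label v) r
    refines (old _) = refines-refl
    refines (inA a) = refinesA a
    refines (inB b) = refinesB b

    old-edge : ∀ {p o n x n′ x′} → Emb p (marker n x) → Emb o (marker n′ x′) → T.opposite p ≡ o →
               JoinFree (S.label n) x (S.label n′) x′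
    old-edge {marker _ _} {marker _ _} e e′ op≡ =
      joinFree-refines (refines e) (refines e′)
        (case joins _ _ _ _ op≡ of λ (¬cliques , ¬stars) → excluding ¬cliques ¬stars)

module _ {Leaf : Set} (τ : GLT Leaf) (isGLT : IsGLT τ)
         (q : Element Leaf (GLT.label τ)) (W : GraphOn Ternary) where
  open Subdivide τ isGLT q W

  -- Only old edges and the two halves of the subdivided one can be joined; the edge at `opp-x` ends
  -- in a leaf.
  subdivide-isReduced :
    (∀ v → IsPrime (T.label v) ⊎ IsDegenerate (T.label v)) → IsDegenerate wLabel →
    (∀ {v r v′ r′} → marker v r ≢ q → marker v r ≢ T.opposite q →
      T.opposite (marker v r) ≡ marker v′ r′ → JoinFree (T.label v) r (T.label v′) r′) →
    (∀ {v r} → q ≡ marker v r → JoinFree (T.label v) r wLabel opp-q) →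
    (∀ {v r} → T.opposite q ≡ marker v r → JoinFree (T.label v) r wLabel opp-q′) →
    IsReduced (subdivide τ q W)
  subdivide-isReduced kind degenerate old-free q-free q′-free =
    (λ { (just v) → kind v ; nothing → inj₂ degenerate }) , λ n r n′ r′ op≡ →
      let open JoinFree (joinFree {n} {r} {n′} {r′} op≡) in no-clique-join , no-star-join
    where
    keep≢w : ∀ {p i} → keep τ q W p ≢ marker nothing i
    keep≢w {leaf _}     ()
    keep≢w {marker _ _} ()

    joinFree : ∀ {n r n′ r′} → S.opposite (marker n r) ≡ marker n′ r′ →
               JoinFree (S.label n) r (S.label n′) r′
    joinFree {nothing} {opp-q}  {nothing}  op≡ = contradiction op≡ keep≢w
    joinFree {nothing} {opp-q′} {nothing}  op≡ = contradiction op≡ keep≢w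
    joinFree {nothing} {opp-q}  {just v′} {r′} op≡ =
      joinFree-sym (q-free (keep-marker op≡))
    joinFree {nothing} {opp-q′} {just v′} {r′} op≡ =
      joinFree-sym (q′-free (keep-marker op≡))
    joinFree {just v} {r} {n′} {r′} op≡ = at (marker v r T.≟ᴱ q) (marker v r T.≟ᴱ T.opposite q) op≡
      where
      at : ∀ {n′ r′} → Dec (marker v r ≡ q) → Dec (marker v r ≡ T.opposite q) →
           S.opposite (marker (just v) r) ≡ marker n′ r′ → JoinFree (T.label v) r (S.label n′) r′
      at (yes e) _ op≡
        with trans (sym opposite-keep-q) (trans (cong (S.opposite ∘ keep τ q W) (sym e)) op≡)
      ... | refl = q-free (sym e)
      at (no _) (yes e) op≡
        with trans (sym opposite-keep-q′) (trans (cong (S.opposite ∘ keep τ q W) (sym e)) op≡)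
      ... | refl = q′-free (sym e)
      at {just v′} (no ≢q) (no ≢q′) op≡ =
        old-free ≢q ≢q′ (keep-marker (trans (sym (opposite-keep-other ≢q ≢q′)) op≡))
      at {nothing} (no ≢q) (no ≢q′) op≡ =
        contradiction (trans (sym (opposite-keep-other ≢q ≢q′)) op≡) keep≢w

-- The accessibility graph after subdivision

module _ (G : Graph) (N : Subset (Graph.Vertex G)) (τ : GLT (Graph.Vertex G)) (isGLT : IsGLT τ)
         (q : Element (Graph.Vertex G) (GLT.label τ)) where
  private module Tτ = Walks τ
  open Tτ.Tree isGLT

  -- The right-hand side describes the old leaves reached from the new one, expressed in the tree
  -- before subdivision.
  NeighboursAlong : GraphOn Ternary → Set
  NeighboursAlong W = ∀ m → T (N m) ⇔
    ( (T (adj opp-x opp-q) × Tτ.Out (Tτ.opposite q) (inj₁ m))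
    ⊎ (T (adj opp-x opp-q′) × Tτ.Out q (inj₁ m)))
    where open GraphOn W

  -- Every leaf lies beyond `q` or beyond its opposite, and on each side perfection identifies N(x)
  -- with the leaves reached.
  neighbours-clique : Perfect τ N q → Perfect τ N (Tτ.opposite q) → NeighboursAlong clique₃
  neighbours-clique perfect perfect′ m = mk⇔ to
    [ perfect-Out⇒N N perfect′ ∘ proj₂ , perfect-Out⇒N N perfect ∘ proj₂ ]′
    where
    to : T (N m) → _
    to n = [ (λ past → inj₂ (_ , perfect-N⇒Out N perfect n past))
           , (λ past → inj₁ (_ , perfect-N⇒Out N perfect′ n past)) ]′ (past-total q (inj₁ m))

  -- From x a star centred at `opp-q` leads only to the side beyond the opposite of `q`, where
  -- perfection applies; beyond `q` there is nothing of N(x) to reach.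
  neighbours-star : Empty τ N q → Perfect τ N (Tτ.opposite q) → NeighboursAlong (star₃ opp-q)
  neighbours-star empty perfect′ m = mk⇔ to λ { (inj₁ (_ , o)) → perfect-Out⇒N N perfect′ o ; (inj₂ (() , _)) }
    where
    to : T (N m) → _
    to n = [ (λ past → contradiction n (empty⁻ N empty past))
           , (λ past → inj₁ (_ , perfect-N⇒Out N perfect′ n past)) ]′ (past-total q (inj₁ m))

  module _ (W : GraphOn Ternary) where
    open Subdivide τ isGLT q W using (module S; subdivide-isGLT; module OutTransfer)
    open S.Tree subdivide-isGLT using () renaming
      ( Accessible⇒Out to Accessible⇒Out′; Out⇒Alternating to Out⇒Alternating′
      ; out-reverse to out-reverse′; end-opposite² to end-opposite²′ )
    open OutTransfer

    subdivide-isAccessibilityGraph :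
      IsAccessibilityGraph G τ → T (GraphOn.adj W opp-q opp-q′) → NeighboursAlong W →
      IsAccessibilityGraph (G ⊕ N) (subdivide τ q W)
    subdivide-isAccessibilityGraph acc qq′ nbrs = equiv
      where
      x-Out : ∀ m → T (N m) ⇔ S.Out (leaf nothing) (inj₁ (just m))
      x-Out m = mk⇔ (out-x qq′ ∘ Equivalence.to (nbrs m)) (Equivalence.from (nbrs m) ∘ out-x⁻)

      out-sym : ∀ {ℓ m} → S.Out (leaf ℓ) (inj₁ m) → S.Out (leaf m) (inj₁ ℓ)
      out-sym {ℓ} o = out-reverse′ o (S.stop (end-opposite²′ (leaf ℓ)))

      accessible : ∀ {ℓ m} → S.Out (leaf ℓ) (inj₁ m) → Accessible (subdivide τ q W) (leaf ℓ) (leaf m)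
      accessible o = tree-edge , Out⇒Alternating′ o

      equiv : IsAccessibilityGraph (G ⊕ N) (subdivide τ q W)
      equiv nothing  nothing  ℓ≢m = contradiction refl ℓ≢m
      equiv nothing  (just m) ℓ≢m = mk⇔
        (λ n → accessible (Equivalence.to (x-Out m) n))
        (λ a → Equivalence.from (x-Out m) (Accessible⇒Out′ ℓ≢m a))
      equiv (just ℓ) nothing  ℓ≢m = mk⇔
        (λ n → accessible (out-sym (Equivalence.to (x-Out ℓ) n)))
        (λ a → Equivalence.from (x-Out ℓ) (out-sym (Accessible⇒Out′ ℓ≢m a)))
      equiv (just ℓ) (just m) ℓ≢m = mk⇔
        (λ a → accessible (out-kept qq′ (Accessible⇒Out ℓ≢m′ (Equivalence.to (acc ℓ m ℓ≢m′) a))))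
        (λ a → Equivalence.from (acc ℓ m ℓ≢m′)
          (tree-edge , Out⇒Alternating (out-kept⁻ qq′ (Accessible⇒Out′ ℓ≢m a))))
        where
        ℓ≢m′ : ℓ ≢ m
        ℓ≢m′ refl = ℓ≢m refl

-- Degenerate labels and their splits

-- `Split` carries connectedness of the graph, which must be supplied for the label of the hybrid
-- node.
degenerate-connected : (G : Graph) → IsDegenerate G → Connected G
degenerate-connected G (inj₁ clique) u v with Graph._≟_ G u v
... | yes refl = ε
... | no u≢v   = clique u v u≢v ◅ ε
degenerate-connected G (inj₂ (c , _ , adj-c , _)) u v = reverse (Adj-sym G) (from-c u) ◅◅ from-c v
  where
  from-c : ∀ v → Star (Graph.Adj G) c v
  from-c v with Graph._≟_ G v c
  ... | yes refl = ε
  ... | no v≢c   = adj-c v v≢c ◅ ε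

star₃-centre : IsStarCentre (ternaryGraph (star₃ opp-q)) opp-q
star₃-centre = ternary≥3
  , (λ { opp-q ≢ → contradiction refl ≢ ; opp-q′ _ → _ ; opp-x _ → _ })
  , λ { opp-q _ _ → inj₁ refl ; opp-q′ opp-q _ → inj₂ refl ; opp-x opp-q _ → inj₂ refl }

clique₃-clique : IsClique (ternaryGraph clique₃)
clique₃-clique opp-q  opp-q  ≢ = contradiction refl ≢
clique₃-clique opp-q  opp-q′ _ = _
clique₃-clique opp-q  opp-x  _ = _
clique₃-clique opp-q′ opp-q  _ = _
clique₃-clique opp-q′ opp-q′ ≢ = contradiction refl ≢
clique₃-clique opp-q′ opp-x  _ = _
clique₃-clique opp-x  opp-q  _ = _
clique₃-clique opp-x  opp-q′ _ = _
clique₃-clique opp-x  opp-x  ≢ = contradiction refl ≢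

module _ {G : Graph} (s : Split G) where
  open Split s
  open Graph G using (Adj; _≟_)

  private
    GA GB : Graph
    GA = induced G A ⊕ (A′ ∘ proj₁)
    GB = induced G B ⊕ (B′ ∘ proj₁)

    ∉ : ∀ {r} → T (A r) → ¬ T (B r)
    ∉ {r} r∈A r∈B with A r
    ... | true = r∈B

  ∈A′ : ∀ {r y} → T (A r) → T (B y) → Adj y r → T (A′ r)
  ∈A′ a = N[]⁺ G B (∉ a)

  ∈B′ : ∀ {r y} → T (B r) → T (A y) → Adj y r → T (B′ r)
  ∈B′ b = N[]⁺ G A (λ a → ∉ a b)

  some-A : ∃ λ r → T (A r)
  some-A = Injection.to |A|>1 zero

  some-B : ∃ λ r → T (B r)
  some-B = Injection.to |B|>1 zero

  ≢AB : ∀ {r y} → T (A r) → T (B y) → r ≢ y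
  ≢AB a b refl = ∉ a b

  module _ (clique : IsClique G) where

    clique-splitA : IsClique GA
    clique-splitA nothing        nothing        ≢ = contradiction refl ≢
    clique-splitA nothing        (just (r , a)) _ = ∈A′ a (proj₂ some-B) (clique _ _ (≢-sym (≢AB a (proj₂ some-B))))
    clique-splitA (just (r , a)) nothing        _ = ∈A′ a (proj₂ some-B) (clique _ _ (≢-sym (≢AB a (proj₂ some-B))))
    clique-splitA (just (r , a)) (just (y , b)) ≢ = clique r y λ { refl → ≢ (cong (just ∘ (r ,_)) (T-irrelevant a b)) }

    clique-splitB : IsClique GB
    clique-splitB nothing        nothing        ≢ = contradiction refl ≢
    clique-splitB nothing        (just (r , b)) _ = ∈B′ b (proj₂ some-A) (clique _ _ (≢AB (proj₂ some-A) b))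
    clique-splitB (just (r , b)) nothing        _ = ∈B′ b (proj₂ some-A) (clique _ _ (≢AB (proj₂ some-A) b))
    clique-splitB (just (r , a)) (just (y , b)) ≢ = clique r y λ { refl → ≢ (cong (just ∘ (r ,_)) (T-irrelevant a b)) }

    refines-clique : ∀ {H x r} → IsClique H → Refines H x G r
    refines-clique {H} cliqueH = record
      { clique  = λ _ → clique
      ; star    = λ starH → ⊥-elim (clique-not-star H cliqueH starH)
      ; centre⇒ = λ c → ⊥-elim (clique-not-star H cliqueH (_ , c))
      ; centre⇐ = λ c → ⊥-elim (clique-not-star G clique (_ , c))
      }

  module _ {c} (centre : IsStarCentre G c) (c∈B : T (B c)) where
    private
      adj-c : ∀ v → v ≢ c → Adj c v
      adj-c = proj₁ (proj₂ centre)

      joins-c : ∀ u v → Adj u v → u ≡ c ⊎ v ≡ c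
      joins-c = proj₂ (proj₂ centre)

    A⊆A′ : ∀ {r} → T (A r) → T (A′ r)
    A⊆A′ a = ∈A′ a c∈B (adj-c _ (≢AB a c∈B))

    c∈B′ : T (B′ c)
    c∈B′ = ∈B′ c∈B (proj₂ some-A) (Adj-sym G (adj-c _ (≢AB (proj₂ some-A) c∈B)))

    B′⊆c : ∀ {r} → T (B′ r) → r ≡ c
    B′⊆c b′ with N[]⁻ G A b′
    ... | y , y∈A , yr = [ (λ y≡c → contradiction y≡c (≢AB y∈A c∈B)) , id ]′ (joins-c _ _ yr)

    -- `A` consists of leaves of the star, all attached to `c` on the other side, so the new marker
    -- takes over the role of the centre.
    star-splitA : IsStarCentre GA nothing
    star-splitA = atLeast-Maybe |A|>1
      , (λ { nothing ≢ → contradiction refl ≢ ; (just (_ , a)) _ → A⊆A′ a })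
      , λ { nothing  _        _  → inj₁ refl
          ; (just _) nothing  _  → inj₂ refl
          ; (just (r , a)) (just (y , b)) ry → ⊥-elim ([ ≢AB a c∈B , ≢AB b c∈B ]′ (joins-c r y ry)) }

    private
      just-c : ∀ {r} (b : T (B r)) → r ≡ c → just (r , b) ≡ just (c , c∈B)
      just-c b refl = cong (just ∘ (c ,_)) (T-irrelevant b c∈B)

    -- An edge from `A` into `B` must end in `c`. The frontier is thus `c` alone, and the new marker
    -- becomes one more leaf of the star.
    star-splitB : IsStarCentre GB (just (c , c∈B))
    star-splitB = atLeast-Maybe |B|>1
      , (λ { nothing _ → c∈B′ ; (just (r , b)) ≢ → adj-c r (≢ ∘ just-c b) })
      , λ { nothing        nothing        ()
          ; nothing        (just (y , b)) b′ → inj₂ (just-c b (B′⊆c b′))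
          ; (just (r , b)) nothing        b′ → inj₁ (just-c b (B′⊆c b′))
          ; (just (r , b)) (just (y , b₁)) ry → [ inj₁ ∘ just-c b , inj₂ ∘ just-c b₁ ]′ (joins-c r y ry) }

    -- No old marker in `A` is a centre, before or after the split: the old centre lies in `B` and
    -- the new one is the new marker.
    refines-starA : ∀ {r} (a : T (A r)) → Refines GA (just (r , a)) G r
    refines-starA a = record
      { clique  = λ cliqueA → ⊥-elim (clique-not-star GA cliqueA (_ , star-splitA))
      ; star    = λ _ → c , centre
      ; centre⇒ = λ d → case IsStarCentre-unique GA star-splitA d of λ ()
      ; centre⇐ = λ d → contradiction (IsStarCentre-unique G d centre) (≢AB a c∈B)
      }

    refines-starB : ∀ {r} (b : T (B r)) → Refines GB (just (r , b)) G r
    refines-starB b = record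
      { clique  = λ cliqueB → ⊥-elim (clique-not-star GB cliqueB (_ , star-splitB))
      ; star    = λ _ → c , centre
      ; centre⇒ = λ d → subst (IsStarCentre G)
          (sym (cong proj₁ (just-injective (IsStarCentre-unique GB d star-splitB)))) centre
      ; centre⇐ = λ d → subst (IsStarCentre GB) (sym (just-c b (IsStarCentre-unique G d centre))) star-splitB
      }

-- The hybrid node

module Hybrid (G : Graph) (N : Subset (Graph.Vertex G)) (τ : GLT (Graph.Vertex G))
              (isSplitTree : IsSplitTree G τ) (u : GLT.Node τ) (hybrid : IsHybrid τ N u) where
  private
    isGLT : IsGLT τ
    isGLT = proj₁ isSplitTree

    reduced : IsReduced τ
    reduced = proj₁ (proj₂ isSplitTree)

    H : Graph
    H = GLT.label τ u

    module T = Walks τ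

  open T.Tree isGLT
  open Graph H using (Vertex; Adj; adj; _≟_; finite)

  PerfectAt EmptyAt : Vertex → Set
  PerfectAt r = Perfect τ N (marker u r)
  EmptyAt   r = Empty τ N (marker u r)

  some-out : ∀ p → ∃ λ m → T.Out p (inj₁ m)
  some-out = out-nonempty λ v → degenerate-neighbour (T.label v) (degree≥3 v) (proj₁ reduced v)

  -- A leaf accessible from the marker would have to belong to N(x) and not to belong to it.
  perfect-not-empty : ∀ {r} → PerfectAt r → ¬ EmptyAt r
  perfect-not-empty = perfect⇒nonempty N (proj₂ (some-out _))

  perfect? : Decidable PerfectAt
  perfect? r with proj₁ hybrid r
  ... | inj₁ perfect = yes perfect
  ... | inj₂ empty   = no λ perfect → perfect-not-empty perfect empty

  not-perfect⇒empty : ∀ {r} → ¬ PerfectAt r → EmptyAt r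
  not-perfect⇒empty {r} ¬perfect = [ ⊥-elim ∘ ¬perfect , id ]′ (proj₁ hybrid r)

  -- The opposite of `q` is perfect as soon as every other marker is perfect when adjacent to `q`
  -- and empty when not. These are the two ways to fail.
  Mismatch : Vertex → Vertex → Set
  Mismatch q r = PerfectAt r × ¬ Adj q r ⊎ EmptyAt r × Adj q r

  -- If all other markers were empty, so would be the opposite of `q`, which is mixed.
  other-perfect : ∀ q → ∃ λ r → q ≢ r × PerfectAt r
  other-perfect q with ∃? finite (λ r → ¬? (q ≟ r) ×-dec perfect? r)
  ... | yes found = found
  ... | no none   = contradiction (empty⁺ N no-neighbour) (proj₂ (proj₂ hybrid q))
    where
    no-neighbour : ∀ {m} → T.Past (T.opposite (marker u q)) (inj₁ m) → ¬ T (N m)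
    no-neighbour past with around past
    ... | r , q≢r , b = empty⁻ N (not-perfect⇒empty λ perfect → none (r , q≢r , perfect)) b

  -- Without a mismatch the walks around `q` would show the opposite of `q` to be perfect, which is
  -- again excluded by its being mixed.
  other-mismatch : ∀ q → ∃ λ r → q ≢ r × Mismatch q r
  other-mismatch q with ∃? finite (λ r → ¬? (q ≟ r) ×-dec mismatch? r)
    where
    mismatch? : Decidable (Mismatch q)
    mismatch? r = (perfect? r ×-dec ¬? (T? (adj q r))) ⊎-dec
                  (map′ not-perfect⇒empty (λ empty perfect → perfect-not-empty perfect empty) (¬? (perfect? r))
                    ×-dec T? (adj q r))
  ... | yes found = found
  ... | no none   = contradiction (perfect⁺ N to from) (proj₁ (proj₂ hybrid q))
    where
    to : ∀ {m} → T (N m) → T.Past (T.opposite (marker u q)) (inj₁ m) → T.Out (T.opposite (marker u q)) (inj₁ m)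
    to n past with around past
    ... | r , q≢r , b with proj₁ hybrid r | T? (adj q r)
    ...   | inj₂ empty   | _      = contradiction n (empty⁻ N empty b)
    ...   | inj₁ perfect | yes qr = around⁻ qr (perfect-N⇒Out N perfect n b)
    ...   | inj₁ perfect | no ¬qr = contradiction (r , q≢r , inj₁ (perfect , ¬qr)) none

    from : ∀ {m} → T.Out (T.opposite (marker u q)) (inj₁ m) → T (N m)
    from out with around out
    ... | r , qr , o with proj₁ hybrid r
    ...   | inj₁ perfect = perfect-Out⇒N N perfect o
    ...   | inj₂ empty   = contradiction (r , Adj⇒≢ H qr , inj₂ (empty , qr)) none

  -- `P*` refers to centres, and cliques and stars decide in different ways which markers are
  -- centres; hence the parameter.
  module Splitting (centre? : Decidable (IsStarCentre H)) where

    P*? : Decidable (P* τ N u)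
    P*? r = perfect? r ×-dec ¬? (centre? r)

    A* : Subset Vertex
    A* r = ⌊ P*? r ⌋

    record P*-E*-Split : Set where
      field
        split : Split H
        A≐P*  : ⟦ Split.A split ⟧ ≐ P* τ N u
        B≐E*  : ⟦ Split.B split ⟧ ≐ E* τ N u

    -- The neighbour of `b` in `P*` is handed to the last argument because in a star it identifies
    -- `b` as the centre.
    mkSplit : IsDegenerate H →
              ∀ {a₁ a₂ b₁ b₂} → a₁ ≢ a₂ → P* τ N u a₁ → P* τ N u a₂ →
              b₁ ≢ b₂ → E* τ N u b₁ → E* τ N u b₂ →
              (∀ {a b} → P* τ N u a → E* τ N u b → (∃ λ y → P* τ N u y × Adj y b) → Adj a b) →
              P*-E*-Split
    mkSplit degenerate a₁≢a₂ a₁∈ a₂∈ b₁≢b₂ b₁∈ b₂∈ joined = record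
      { split = record
        { A         = A*
        ; connected = degenerate-connected H degenerate
        ; |A|>1     = atLeast2 {a = _ , fromWitness a₁∈} {_ , fromWitness a₂∈} (a₁≢a₂ ∘ cong proj₁)
        ; |B|>1     = atLeast2 {a = _ , E*⇒B b₁∈} {_ , E*⇒B b₂∈} (b₁≢b₂ ∘ cong proj₁)
        ; joined    = λ a b a∈A′ b∈B′ → joined (in-A a a∈A′) (in-B b b∈B′)
            (map₂ (λ (y∈A , yb) → toWitness y∈A , yb) (N[]⁻ H A* b∈B′))
        }
      ; A≐P* = toWitness , fromWitness
      ; B≐E* = B⇒E* , E*⇒B
      }
      where
      E*⇒B : ∀ {r} → E* τ N u r → T (∁ A* r)
      E*⇒B (inj₁ empty)        = fromWitnessFalse λ (perfect , _) → perfect-not-empty perfect empty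
      E*⇒B (inj₂ (_ , centre)) = fromWitnessFalse λ (_ , ¬centre) → ¬centre centre

      B⇒E* : ∀ {r} → T (∁ A* r) → E* τ N u r
      B⇒E* {r} r∈B with perfect? r | centre? r
      ... | yes perfect | yes centre = inj₂ (perfect , centre)
      ... | no ¬perfect | _          = inj₁ (not-perfect⇒empty ¬perfect)

      in-A : ∀ r → T (Graph.N[_] H (∁ A*) r) → P* τ N u r
      in-A r r∈ with P*? r
      ... | yes p = p

      in-B : ∀ r → T (Graph.N[_] H A* r) → E* τ N u r
      in-B r r∈ = B⇒E* (T-∧-proj₁ r∈)
        where
        T-∧-proj₁ : ∀ {x y} → T (x ∧ y) → T x
        T-∧-proj₁ = proj₁ ∘ Equivalence.to T-∧

    module SplitStates (sp : P*-E*-Split) where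
      open P*-E*-Split sp public
      open Split split using (A; B; A′; B′)
      open NodeSplit τ isGLT u split public using (module PastTransfer; module OutTransfer; split-isGLT)
      private
        τ₁ : GLT (Graph.Vertex G)
        τ₁ = nodeSplit τ u split
        q q′ : Element (Graph.Vertex G) (GLT.label τ₁)
        q  = splitEdgeA τ u split
        q′ = splitEdgeB τ u split
        module S = Walks τ₁
        module STree = S.Tree split-isGLT

      module _ (A⊆A′ : ∀ {r} → T (A r) → T (A′ r)) where
        edgeB-perfect : Perfect τ₁ N q′
        edgeB-perfect = STree.perfect⁺ N to from
          where
          to : ∀ {m} → T (N m) → S.Past q′ (inj₁ m) → S.Out q′ (inj₁ m)
          to n past with PastTransfer.beyond-edgeB past
          ... | (r , a) , _ , b =
            OutTransfer.beyond-edgeB⁻ {y = r , a} (A⊆A′ a) (perfect-N⇒Out N (proj₁ (proj₁ A≐P* a)) n b)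
          from : ∀ {m} → S.Out q′ (inj₁ m) → T (N m)
          from out with OutTransfer.beyond-edgeB out
          ... | (r , a) , _ , o = perfect-Out⇒N N (proj₁ (proj₁ A≐P* a)) o

        edgeB-not-empty : ¬ Empty τ₁ N q′
        edgeB-not-empty = STree.perfect⇒nonempty N
          (OutTransfer.beyond-edgeB⁻ {y = some-A split} (A⊆A′ (proj₂ (some-A split))) (proj₂ (some-out _)))
          edgeB-perfect

      edgeA-empty : (∀ {r} → T (B r) → EmptyAt r) → Empty τ₁ N q
      edgeA-empty B-empty = STree.empty⁺ N λ past → case PastTransfer.beyond-edgeA past of λ
        { ((_ , r∈B) , _ , b) → empty⁻ N (B-empty r∈B) b }

      edgeA-not-perfect : ∀ {r} → T (B r) → T (B′ r) → Empty τ₁ N q → ¬ Perfect τ₁ N q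
      edgeA-not-perfect {r} r∈B r∈B′ empty perfect = STree.perfect⇒nonempty N
        (OutTransfer.beyond-edgeA⁻ {y = r , r∈B} r∈B′ (proj₂ (some-out _))) perfect empty

      -- Beyond this extremity N(x) can only lie behind `c`, since the rest of `B` is empty; and
      -- `c`, being the whole frontier, is also the only marker that label-edges lead to.
      edgeA-perfect : ∀ {c} → PerfectAt c → (∀ {r} → T (B r) → EmptyAt r ⊎ r ≡ c) →
                      T (B c) → T (B′ c) → (∀ {r} → T (B′ r) → r ≡ c) → Perfect τ₁ N q
      edgeA-perfect {c} perfect B-states c∈B c∈B′ B′⊆c = STree.perfect⁺ N to from
        where
        to : ∀ {m} → T (N m) → S.Past q (inj₁ m) → S.Out q (inj₁ m)
        to n past with PastTransfer.beyond-edgeA past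
        ... | (r , r∈B) , _ , b with B-states r∈B
        ...   | inj₁ empty = contradiction n (empty⁻ N empty b)
        ...   | inj₂ refl  = OutTransfer.beyond-edgeA⁻ {y = c , c∈B} c∈B′ (perfect-N⇒Out N perfect n b)
        from : ∀ {m} → S.Out q (inj₁ m) → T (N m)
        from out with OutTransfer.beyond-edgeA out
        ... | (r , _) , r∈B′ , o with B′⊆c r∈B′
        ...   | refl = perfect-Out⇒N N perfect o

      module _
        (degenerateA : IsDegenerate (S.label nodeA)) (degenerateB : IsDegenerate (S.label nodeB))
        (refinesA : ∀ {r} (a : T (A r)) → Refines (S.label nodeA) (just (r , a)) H r)
        (refinesB : ∀ {r} (b : T (B r)) → Refines (S.label nodeB) (just (r , b)) H r)
        (W : GraphOn Ternary) where
        splitTree : IsDegenerate (ternaryGraph W) → JoinFree (S.label nodeA) nothing (ternaryGraph W) opp-q →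
                    JoinFree (S.label nodeB) nothing (ternaryGraph W) opp-q′ → T (GraphOn.adj W opp-q opp-q′) →
                    NeighboursAlong G N τ₁ split-isGLT q W →
                    IsSplitTree (G ⊕ N) (subdivide τ₁ q W)
        splitTree degenerateW freeA freeB qq′ nbrs =
          Subdivide.subdivide-isGLT τ₁ split-isGLT q W ,
          subdivide-isReduced τ₁ split-isGLT q W
            (λ { (old v _) → proj₁ reduced v ; nodeA → inj₂ degenerateA ; nodeB → inj₂ degenerateB })
            degenerateW
            (nodeSplit-joinFree τ isGLT u split reduced refinesA refinesB)
            (λ { refl → freeA }) (λ { refl → freeB }) ,
          subdivide-isAccessibilityGraph G N τ₁ split-isGLT q W accessibility₁ qq′ nbrs
          where
          accessibility₁ : IsAccessibilityGraph G τ₁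
          accessibility₁ ℓ m ℓ≢m = mk⇔
            (λ a → tree-edge , STree.Out⇒Alternating
              (OutTransfer.split-beyond NodeSplit.leaf (Accessible⇒Out ℓ≢m (Equivalence.to (accessibility ℓ m ℓ≢m) a))))
            (λ a → Equivalence.from (accessibility ℓ m ℓ≢m)
              (tree-edge , Out⇒Alternating (OutTransfer.contract-beyond NodeSplit.leaf (STree.Accessible⇒Out ℓ≢m a))))
            where
            accessibility : IsAccessibilityGraph G τ
            accessibility = proj₂ (proj₂ isSplitTree)

  Conclusion : Split H → Set
  Conclusion s =
    (⟦ Split.A s ⟧ ≐ P* τ N u) × (⟦ Split.B s ⟧ ≐ E* τ N u) ×
    (Perfect τ₁ N q ⊎ Empty τ₁ N q) × (Perfect τ₁ N q′ ⊎ Empty τ₁ N q′) ×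
    (Perfect τ₁ N q → Perfect τ₁ N q′ →
      IsSplitTree (G ⊕ N) (subdivide τ₁ q clique₃)) ×
    (¬ (Perfect τ₁ N q × Perfect τ₁ N q′) →
      (Empty τ₁ N q × ¬ Empty τ₁ N q′ ×
        IsSplitTree (G ⊕ N) (subdivide τ₁ q (star₃ opp-q)))
      ⊎
      (Empty τ₁ N q′ × ¬ Empty τ₁ N q ×
        IsSplitTree (G ⊕ N) (subdivide τ₁ q (star₃ opp-q′))))
    where
    τ₁ : GLT (Graph.Vertex G)
    τ₁ = nodeSplit τ u s
    q q′ : Element (Graph.Vertex G) (GLT.label τ₁)
    q  = splitEdgeA τ u s
    q′ = splitEdgeB τ u s

  private
    r₀ : Vertex
    r₀ = Injection.to (degree≥3 u) zero

  -- Without centres `E*` is made of empty markers, so the extremity looking at it is empty and the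
  -- outcome with two perfect extremities cannot arise. The new star separates the two cliques and
  -- can be joined to neither.
  clique-case : IsClique H → Σ (Split H) Conclusion
  clique-case clique = split , A≐P* , B≐E* , inj₂ q-empty , inj₁ q′-perfect ,
    (λ q-perfect _ → contradiction q-perfect q-not-perfect) ,
    λ _ → inj₁ (q-empty , edgeB-not-empty A⊆A′-clique ,
      splitTree (inj₁ cliqueA) (inj₁ cliqueB) (λ _ → refines-clique split clique cliqueA)
        (λ _ → refines-clique split clique cliqueB) (star₃ opp-q) (inj₂ (opp-q , star₃-centre))
        (joinFree-clique-star cliqueA (opp-q , star₃-centre))
        (joinFree-clique-star cliqueB (opp-q , star₃-centre)) _
        (neighbours-star G N _ split-isGLT _ q-empty q′-perfect))
    where
    no-centre : ∀ {r} → ¬ IsStarCentre H r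
    no-centre centre = clique-not-star H clique (_ , centre)

    open Splitting (λ _ → no no-centre)

    -- In a clique every other marker is adjacent to `q`, so a mismatch can only be an empty marker.
    other-empty : ∀ q → ∃ λ r → q ≢ r × EmptyAt r
    other-empty q with other-mismatch q
    ... | r , q≢r , inj₁ (_ , ¬qr)   = contradiction (clique q r q≢r) ¬qr
    ... | r , q≢r , inj₂ (empty , _) = r , q≢r , empty

    E*-empty : ∀ {r} → E* τ N u r → EmptyAt r
    E*-empty (inj₁ empty)        = empty
    E*-empty (inj₂ (_ , centre)) = contradiction centre no-centre

    sp : P*-E*-Split
    -- `r₀` is arbitrary and merely starts the search; excluding each first witness then yields a
    -- second one of the same state.
    sp with other-perfect r₀ | other-empty r₀
    ... | a , _ , a-perfect | b , _ , b-empty with other-perfect a | other-empty b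
    ...   | a′ , a≢a′ , a′-perfect | b′ , b≢b′ , b′-empty =
      mkSplit (inj₁ clique) a≢a′ (a-perfect , no-centre) (a′-perfect , no-centre)
        b≢b′ (inj₁ b-empty) (inj₁ b′-empty)
        λ (perfect , _) e _ → clique _ _ λ { refl → perfect-not-empty perfect (E*-empty e) }

    open SplitStates sp

    cliqueA = clique-splitA split clique
    cliqueB = clique-splitB split clique

    A⊆A′-clique : ∀ {r} → T (Split.A split r) → T (Split.A′ split r)
    A⊆A′-clique a = cliqueA nothing (just (_ , a)) λ ()

    q′-perfect = edgeB-perfect A⊆A′-clique
    q-empty    = edgeA-empty λ b → E*-empty (proj₁ B≐E* b)
    q-not-perfect = edgeA-not-perfect (proj₂ (some-B split))
      (cliqueB nothing (just (some-B split)) λ ()) q-empty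

  module StarCase {c} (centre : IsStarCentre H c) where
    private
      adj-c : ∀ v → v ≢ c → Adj c v
      adj-c = proj₁ (proj₂ centre)

      joins-c : ∀ u v → Adj u v → u ≡ c ⊎ v ≡ c
      joins-c = proj₂ (proj₂ centre)

      non-centre : ∀ {r} → c ≢ r → ¬ IsStarCentre H r
      non-centre c≢r centre′ = c≢r (IsStarCentre-unique H centre centre′)

      centre? : Decidable (IsStarCentre H)
      centre? r with c ≟ r
      ... | yes refl = yes centre
      ... | no c≢r   = no (non-centre c≢r)

    open Splitting centre? public

    c∈E* : E* τ N u c
    c∈E* = [ (λ perfect → inj₂ (perfect , centre)) , inj₁ ]′ (proj₁ hybrid c)

    -- The centre is adjacent to all other markers, so its mismatch is an empty leaf of the star.
    -- Together with the centre itself it gives two elements of `E*`.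
    empty-leaf : ∃ λ r → c ≢ r × E* τ N u r
    empty-leaf with other-mismatch c
    ... | r , c≢r , inj₁ (_ , ¬cr)   = contradiction (adj-c r (≢-sym c≢r)) ¬cr
    ... | r , c≢r , inj₂ (empty , _) = r , c≢r , inj₁ empty

    -- If the centre is perfect, the mismatch at the leaf `a` cannot be an empty neighbour, the only
    -- neighbour being the centre; so it is a perfect marker not adjacent to `a`, thus not the
    -- centre. If the centre is empty, any other perfect marker will do.
    second-perfect : ∀ {a} → c ≢ a → ∃ λ a′ → a ≢ a′ × P* τ N u a′
    second-perfect {a} c≢a with proj₁ hybrid c
    second-perfect {a} c≢a | inj₁ c-perfect with other-mismatch a
    ... | r , a≢r , inj₁ (perfect , ¬ar) = r , a≢r , perfect ,
          non-centre λ { refl → ¬ar (Adj-sym H (adj-c a (≢-sym c≢a))) }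
    ... | r , a≢r , inj₂ (empty , ar) with joins-c a r ar
    ...   | inj₁ a≡c  = contradiction (sym a≡c) c≢a
    ...   | inj₂ refl = contradiction empty (perfect-not-empty c-perfect)
    second-perfect {a} c≢a | inj₂ c-empty with other-perfect a
    ... | r , a≢r , perfect = r , a≢r , perfect , non-centre λ { refl → perfect-not-empty perfect c-empty }

    sp : P*-E*-Split
    sp with other-perfect c | empty-leaf
    ... | a , c≢a , a-perfect | b , c≢b , b∈E* with second-perfect c≢a
    ...   | a′ , a≢a′ , a′∈P* =
      mkSplit (inj₂ (c , centre)) a≢a′ (a-perfect , non-centre c≢a) a′∈P* c≢b c∈E* b∈E* joined
      where
      -- `y` is a leaf of the star, so its neighbour `b` is the centre, to which `a` is adjacent.
      joined : ∀ {a b} → P* τ N u a → E* τ N u b → (∃ λ y → P* τ N u y × Adj y b) → Adj a b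
      joined (_ , ¬centre-a) _ (y , (_ , ¬centre-y) , yb) with joins-c _ _ yb
      ... | inj₁ refl = contradiction centre ¬centre-y
      ... | inj₂ refl = Adj-sym H (adj-c _ λ { refl → ¬centre-a centre })

    open SplitStates sp

    private
      c∈B : T (Split.B split c)
      c∈B = proj₂ B≐E* c∈E*

      starA = star-splitA split centre c∈B
      starB = star-splitB split centre c∈B

      q′-perfect = edgeB-perfect (A⊆A′ split centre c∈B)

      star-splitTree = splitTree (inj₂ (_ , starA)) (inj₂ (_ , starB))
        (refines-starA split centre c∈B) (refines-starB split centre c∈B)

      B-states : ∀ {r} → T (Split.B split r) → EmptyAt r ⊎ r ≡ c
      B-states b with proj₁ B≐E* b
      ... | inj₁ empty         = inj₁ empty
      ... | inj₂ (_ , centre′) = inj₂ (IsStarCentre-unique H centre′ centre)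

    -- The state of `c` decides: a perfect centre makes both extremities perfect and puts a clique
    -- between the two stars, an empty one leads to a star centred at `opp-q`.
    star-case : Σ (Split H) Conclusion
    star-case with proj₁ hybrid c
    ... | inj₁ c-perfect = split , A≐P* , B≐E* , inj₁ q-perfect , inj₁ q′-perfect ,
        (λ _ _ → star-splitTree clique₃ (inj₁ clique₃-clique)
          (joinFree-sym (joinFree-clique-star clique₃-clique (_ , starA)))
          (joinFree-sym (joinFree-clique-star clique₃-clique (_ , starB))) _
          (neighbours-clique G N _ split-isGLT _ q-perfect q′-perfect)) ,
        λ ¬perfect → contradiction (q-perfect , q′-perfect) ¬perfect
      where
      q-perfect = edgeA-perfect c-perfect B-states c∈B (c∈B′ split centre c∈B) (B′⊆c split centre c∈B)
    ... | inj₂ c-empty = split , A≐P* , B≐E* , inj₂ q-empty , inj₁ q′-perfect ,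
        (λ q-perfect _ → contradiction q-perfect
          (edgeA-not-perfect c∈B (c∈B′ split centre c∈B) q-empty)) ,
        λ _ → inj₁ (q-empty , edgeB-not-empty (A⊆A′ split centre c∈B) ,
          star-splitTree (star₃ opp-q) (inj₂ (opp-q , star₃-centre))
            -- A star-join needs exactly one centre. Towards `nodeA` two centres face each other,
            -- towards `nodeB` two non-centres.
            (joinFree-stars (_ , starA) (λ _ → star₃-centre) (λ _ → starA))
            (joinFree-stars (_ , starB)
              (λ d → case IsStarCentre-unique (GLT.label (nodeSplit τ u split) nodeB) d starB of λ ())
              (λ d → case IsStarCentre-unique (ternaryGraph (star₃ opp-q)) d star₃-centre of λ ())) _
            (neighbours-star G N _ split-isGLT _ q-empty q′-perfect))
      where
      q-empty = edgeA-empty λ b → [ id , (λ { refl → c-empty }) ]′ (B-states b)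

proposition4p16 :
    (G : Graph) (N : Subset (Graph.Vertex G)) → Connected G → Connected (G ⊕ N) →
    (τ : GLT (Graph.Vertex G)) → IsSplitTree G τ →
    (u : GLT.Node τ) → IsHybrid τ N u → (∀ v → IsHybrid τ N v → v ≡ u) →
    IsDegenerate (GLT.label τ u) →
    Σ (Split (GLT.label τ u)) λ s →
      let τ₁ = nodeSplit τ u s
          q  = splitEdgeA τ u s
          q′ = splitEdgeB τ u s
      in
      (⟦ Split.A s ⟧ ≐ P* τ N u) × (⟦ Split.B s ⟧ ≐ E* τ N u) ×
      (Perfect τ₁ N q ⊎ Empty τ₁ N q) × (Perfect τ₁ N q′ ⊎ Empty τ₁ N q′) ×
      (Perfect τ₁ N q → Perfect τ₁ N q′ →
        IsSplitTree (G ⊕ N) (subdivide τ₁ q clique₃)) ×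
      (¬ (Perfect τ₁ N q × Perfect τ₁ N q′) →
        (Empty τ₁ N q × ¬ Empty τ₁ N q′ ×
          IsSplitTree (G ⊕ N) (subdivide τ₁ q (star₃ opp-q)))
        ⊎
        (Empty τ₁ N q′ × ¬ Empty τ₁ N q ×
          IsSplitTree (G ⊕ N) (subdivide τ₁ q (star₃ opp-q′))))
proposition4p16 G N _ _ τ isSplitTree u hybrid _ degenerate =
  [ clique-case , (λ (_ , centre) → StarCase.star-case centre) ]′ degenerate
  where open Hybrid G N τ isSplitTree u hybrid
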